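{- For all integers $0\le k\le r$ there is a constant $\mu$ depending only on $k$ such that for all integers $c_{k-1}>c_{k-2}>\dots>c_1>\mu$, \[f\left(r,k,\binom{c_{k-1}}{k-1}+\binom{c_{k-2}}{k-2}+\dots+\binom{c_1}{1}\right)=\binom{c_{k-1}}{k}+\binom{c_{k-2}}{k-1}+\dots+\binom{c_1}{2}.\]
   Context: $\mathbb{N}^{(s)}$ denotes the family of all $s$-element subsets of $\mathbb{N}$. For integers $0\le k\le r$ and $b\ge 0$, $f(r,k,b)$ denotes the maximum of $|\mathcal{A}|$ over all pairs of families $\mathcal{A}\subset\mathbb{N}^{(r)}$, $\mathcal{B}\subset\mathbb{N}^{(r-1)}$ with $|\mathcal{B}|=b$ such that for every $A\in\mathcal{A}$ there exist $k$ distinct sets $B_1,\dots,B_k\in\mathcal{B}$ with $B_i\subset A$ for all $i$.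
   Formalization: The case k = 0 is excluded: there both sums are empty, f(0,0,0) = 1 rather than 0, and for r ≥ 1 the maximum f(r,0,0) does not exist; the theorem is stated for all 1 ≤ k ≤ r. -}

module Defs where

open import Level using (0ℓ)
open import Data.Fin using (Fin)
open import Data.List using (List; length; sum; applyUpTo)
open import Data.List.Membership.Propositional using (_∈_)
open import Data.List.Relation.Unary.All using (All)
open import Data.List.Relation.Unary.AllPairs using (AllPairs)
open import Data.List.Relation.Unary.Unique.Propositional using (Unique)
open import Data.Nat using (ℕ; suc; _+_; _≤_; _<_)
open import Data.Product using (_×_; ∃; ∃₂; ∃-syntax)
open import Function using (_∘_; _⇔_; Injective)
open import Relation.Binary.PropositionalEquality using (_≡_)
open import Relation.Unary using (Pred)

-- A finite subset of ℕ is represented by its strictly increasing enumeration.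
-- The proof is irrelevant, so _≡_ on FinSet is equality of sets.
record FinSet : Set where
  constructor mkFinSet
  field
    elements    : List ℕ
    .increasing : AllPairs _<_ elements

open FinSet public

card : FinSet → ℕ
card A = length (elements A)

infix 4 _⊆ₛ_

_⊆ₛ_ : FinSet → FinSet → Set
B ⊆ₛ A = ∀ {x} → x ∈ elements B → x ∈ elements A

-- Families may be infinite.
Family : Set₁
Family = Pred FinSet 0ℓ

HasSize : Family → ℕ → Set
HasSize 𝒜 n = ∃[ As ] Unique As × length As ≡ n × (∀ A → 𝒜 A ⇔ A ∈ As)

-- |𝒜| ≤ n; in particular, this fails for infinite 𝒜.
SizeAtMost : Family → ℕ → Set
SizeAtMost 𝒜 n = ∀ As → Unique As → All 𝒜 As → length As ≤ n

ContainsDistinct : ℕ → Family → FinSet → Set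
ContainsDistinct k ℬ A =
  ∃[ B ] Injective {A = Fin k} _≡_ _≡_ B × (∀ i → ℬ (B i) × B i ⊆ₛ A)

record Admissible (r k b : ℕ) (𝒜 ℬ : Family) : Set where
  field
    𝒜-uniform : ∀ A → 𝒜 A → card A ≡ r
    -- Sets of size r - 1.  Unlike card B ≡ r ∸ 1, this allows no B when r = 0.
    ℬ-uniform : ∀ B → ℬ B → suc (card B) ≡ r
    ℬ-size    : HasSize ℬ b
    covers    : ∀ A → 𝒜 A → ContainsDistinct k ℬ A

-- f(r,k,b) = m.  This is a relation because the maximum need not exist:
-- for example, |𝒜| is unbounded when k = 0 and 2 ≤ r.
f⟨_,_,_⟩≡_ : ℕ → ℕ → ℕ → ℕ → Set₁
f⟨ r , k , b ⟩≡ m =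
  (∃₂ λ 𝒜 ℬ → Admissible r k b 𝒜 ℬ × HasSize 𝒜 m) ×
  (∀ 𝒜 ℬ → Admissible r k b 𝒜 ℬ → SizeAtMost 𝒜 m)

-- g 1 + g 2 + … + g n
∑₁ : ℕ → (ℕ → ℕ) → ℕ
∑₁ n g = sum (applyUpTo (g ∘ suc) n)

{-# OPTIONS --safe #-}

-- Let d = k - 1 ≥ 1, let f(b) be the maximum of |𝒜| for |ℬ| = b, let n = c_d, and
-- for an element v let p and q be the numbers of members of ℬ that contain v and
-- that do not. An A ∈ 𝒜 containing v either satisfies A - v ∈ ℬ, which happens at
-- most q times, or still has k subsets in the link of v. Hence
-- |𝒜| ≤ q + f(p) + f(q) for every v.
--
-- If p = O(n^(d-1)) for all v, then each A ∈ 𝒜 lies in the link of all but k of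
-- its elements with k subsets left there, and double counting against a crude
-- bound f(p) = o(n p) gives |𝒜| = o(n b), which is too small, unless r ≤ k. In
-- that case ℬ contains the full shadow of 𝒜 and the Kruskal–Katona theorem
-- applies. If p is larger for some v and q is also at least of order n^(d-1), then
-- q + f(p) + f(q) is too small by the asymptotic bound f(b) ≤ b (n + O(1)) / (d + 1),
-- which follows from the same dichotomy. If p is larger and q is smaller, then v is
-- removed from the ground set at the cost of q members of ℬ and q + f(q) members
-- of 𝒜. After the removal of S members of ℬ in this way, O(S^(1 + 1/d)) members of
-- 𝒜 have been lost, which is at most the decrease of the Kruskal–Katona bound from
-- b to b - S because all c_i are large.

module Submission where

open import Data.Bool using (Bool; true; false; _∧_; _∨_; not; T)
import Data.Bool.Properties as Bool
open import Data.Fin using (Fin; zero; suc; toℕ; fromℕ<)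
import Data.Fin.Properties as Fin
open import Data.List as List using (List; []; _∷_; length; _++_; reverse; map; concatMap; applyUpTo)
open import Data.List.Extrema.Nat using (max; xs≤max)
import Data.List.Membership.DecPropositional as DecMembership
open import Data.List.Membership.Propositional using (_∈_; _∉_)
open import Data.List.Membership.Propositional.Properties using (∈-map⁺; ∈-map⁻; ∈-++⁺ˡ; ∈-++⁺ʳ; ∈-++⁻; ∈-concatMap⁺)
open import Data.List.Properties using (length-map; length-++; length-reverse; reverse-injective; unfold-reverse; ∷-injectiveʳ; applyUpTo-∷ʳ)
open import Data.List.Relation.Unary.All as All using (All; []; _∷_)
open import Data.List.Relation.Unary.AllPairs using (AllPairs; []; _∷_; allPairs?)
import Data.List.Relation.Unary.AllPairs.Properties as AllPairs
open import Data.List.Relation.Unary.Any as Any using (here; there)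
import Data.List.Relation.Unary.Any.Properties as Any
open import Data.List.Relation.Unary.Unique.Propositional using (Unique)
import Data.List.Relation.Unary.Unique.Propositional.Properties as Unique
open import Data.Nat
open import Data.Nat.Combinatorics
open import Data.Nat.DivMod using (m/n*n≤m; m≡m%n+[m/n]*n; m%n<n; _/_; /-monoˡ-≤; m*n/n≡m)
import Data.Nat.ListAction as ListAction
import Data.Nat.ListAction.Properties as ListAction
open import Data.Nat.Properties
open import Data.Nat.Tactic.RingSolver using (solve-∀)
open import Data.Product using (_×_; _,_; ∃-syntax; proj₁; proj₂)
open import Data.Sum using (_⊎_; inj₁; inj₂)
open import Data.Unit using (tt)
open import Data.Vec as Vec using (Vec; []; _∷_; lookup; insertAt; _[_]≔_; tabulate)
import Data.Vec.Properties as Vec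
open import Function using (_∘_; id; Injective; Equivalence; mk⇔)
open import Relation.Binary.PropositionalEquality
open import Relation.Nullary using (Dec; yes; no; contradiction; does)
open import Relation.Nullary.Decidable using (dec-true; dec-false; recompute)
open import Defs

-- Two quantities must stay out of the constants: r and the number of removed elements. The double
-- count gives (r - k) |𝒜| ≤ (r - 1) b y, and (r - 1) / (r - k) ≤ k once r > k, so r drops out. The
-- number of removals has no bound in terms of k alone, so a separate additive error for each of
-- them would be fatal. The losses are therefore recorded as (d + 1) lost ≤ S (y + E) for every y
-- with S ≤ C(y, d): for a fixed y this is additive in S, and every removal preserves it with the
-- same E.
--
-- The threshold between the cases is `θ` = C(n + 1, d) - C(m, d), where m is n minus a constant. It
-- is only of order n^(d-1), yet a part of size more than `θ` forces all the rest into C(m, d). The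
-- step from n down to m then pays for the term q in the asymptotic bound, and in the exact bound
-- for the gap between C(n + 1, d) n / (d + 1) and C(n, d + 1).

private variable
  N : ℕ

-- Binomial coefficients

pascal : ∀ n k → suc n C suc k ≡ n C k + n C suc k
pascal n k = sym (nCk+nC[k+1]≡[n+1]C[k+1] n k)

absorption : ∀ n k → suc k * (n C suc k) + k * (n C k) ≡ n * (n C k)
absorption zero    zero    = refl
absorption zero    (suc k) = trans (cong₂ _+_ (*-zeroʳ (suc (suc k))) (*-zeroʳ (suc k))) refl
absorption (suc n) zero    = begin
  1 * (suc n C 1) + 0          ≡⟨ cong (λ z → 1 * z + 0) (nC1≡n (suc n)) ⟩
  1 * suc n + 0                ≡⟨ lemma n ⟩
  suc n * 1                    ∎
  where
  open ≡-Reasoning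
  lemma : ∀ n → 1 * suc n + 0 ≡ suc n * 1
  lemma = solve-∀
absorption (suc n) (suc k) = begin
  suc (suc k) * (suc n C suc (suc k)) + suc k * (suc n C suc k)
    ≡⟨ cong₂ (λ u v → suc (suc k) * u + suc k * v) (pascal n (suc k)) (pascal n k) ⟩
  suc (suc k) * (b + e) + suc k * (a + b)
    ≡⟨ regroup k a b e ⟩
  b + a + (suc (suc k) * e + suc k * b) + (suc k * b + k * a)
    ≡⟨ cong₂ (λ u v → b + a + u + v) (absorption n (suc k)) (absorption n k) ⟩
  b + a + n * b + n * a
    ≡⟨ collect n a b ⟩
  suc n * (a + b)
    ≡⟨ cong (suc n *_) (pascal n k) ⟨
  suc n * (suc n C suc k) ∎
  where
  open ≡-Reasoning
  a = n C k
  b = n C suc k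
  e = n C suc (suc k)
  regroup : ∀ k a b e → suc (suc k) * (b + e) + suc k * (a + b) ≡
                        b + a + (suc (suc k) * e + suc k * b) + (suc k * b + k * a)
  regroup = solve-∀
  collect : ∀ n a b → b + a + n * b + n * a ≡ suc n * (a + b)
  collect = solve-∀

C-suc-≤ : ∀ n k → n C k ≤ suc n C k
C-suc-≤ n zero    = ≤-refl
C-suc-≤ n (suc k) = ≤-trans (m≤n+m (n C suc k) (n C k)) (≤-reflexive (sym (pascal n k)))

C-monoˡ-≤ : ∀ {m n} k → m ≤ n → m C k ≤ n C k
C-monoˡ-≤ {m} k m≤n = go (≤⇒≤′ m≤n)
  where
  go : ∀ {n} → m ≤′ n → m C k ≤ n C k
  go (≤′-reflexive refl) = ≤-refl
  go (≤′-step m≤′n)      = ≤-trans (go m≤′n) (C-suc-≤ _ k)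

C-shift-≤ : ∀ n m k → (n + m) C suc k ≤ n C suc k + m * ((n + m) C k)
C-shift-≤ n zero    k = ≤-reflexive (trans (cong (_C suc k) (+-identityʳ n)) (sym (+-identityʳ _)))
C-shift-≤ n (suc m) k = begin
  (n + suc m) C suc k                                ≡⟨ cong (_C suc k) (+-suc n m) ⟩
  suc (n + m) C suc k                                ≡⟨ pascal (n + m) k ⟩
  (n + m) C k + (n + m) C suc k                      ≤⟨ +-monoʳ-≤ ((n + m) C k) (C-shift-≤ n m k) ⟩
  (n + m) C k + (n C suc k + m * ((n + m) C k))      ≡⟨ regroup ((n + m) C k) (n C suc k) m ⟩
  n C suc k + suc m * ((n + m) C k)                  ≤⟨ +-monoʳ-≤ (n C suc k) (*-monoʳ-≤ (suc m) (C-monoˡ-≤ k (+-monoʳ-≤ n (n≤1+n m)))) ⟩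
  n C suc k + suc m * ((n + suc m) C k) ∎
  where
  open ≤-Reasoning
  regroup : ∀ x y m → x + (y + m * x) ≡ y + suc m * x
  regroup = solve-∀

C≤^ : ∀ n k → n C k ≤ n ^ k
C≤^ n       zero    = ≤-refl
C≤^ zero    (suc k) = z≤n
C≤^ (suc n) (suc k) = begin
  suc n C suc k            ≡⟨ pascal n k ⟩
  n C k + n C suc k        ≤⟨ +-mono-≤ (C≤^ n k) (C≤^ n (suc k)) ⟩
  suc n * n ^ k            ≤⟨ *-monoʳ-≤ (suc n) (^-monoˡ-≤ k (n≤1+n n)) ⟩
  suc n * suc n ^ k        ∎
  where open ≤-Reasoning

^≤!*C : ∀ m k → m ^ k ≤ k ! * ((m + k) C k)
^≤!*C m zero    = ≤-refl
^≤!*C m (suc k) = begin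
  m * m ^ k                              ≤⟨ *-monoʳ-≤ m (^≤!*C m k) ⟩
  m * (k ! * ((m + k) C k))              ≡⟨ swap m (k !) ((m + k) C k) ⟩
  k ! * (m * ((m + k) C k))              ≤⟨ *-monoʳ-≤ (k !) step ⟩
  k ! * (suc k * ((m + k) C suc k))      ≡⟨ swap′ (k !) (suc k) ((m + k) C suc k) ⟩
  suc k * k ! * ((m + k) C suc k)        ≤⟨ *-monoʳ-≤ (suc k * k !) (C-monoˡ-≤ (suc k) (+-monoʳ-≤ m (n≤1+n k))) ⟩
  suc k * k ! * ((m + suc k) C suc k)    ∎
  where
  open ≤-Reasoning
  swap : ∀ a b c → a * (b * c) ≡ b * (a * c)
  swap = solve-∀
  swap′ : ∀ a b c → a * (b * c) ≡ b * a * c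
  swap′ = solve-∀
  step : m * ((m + k) C k) ≤ suc k * ((m + k) C suc k)
  step = +-cancelʳ-≤ (k * ((m + k) C k)) _ _ (≤-reflexive
    (trans (sym (*-distribʳ-+ ((m + k) C k) m k)) (sym (absorption (m + k) k))))

C-step-≤ : ∀ n m k → suc (n + m) C suc k ≤ n C suc k + suc m * ((n + m) C k)
C-step-≤ n m k = begin
  suc (n + m) C suc k                              ≡⟨ pascal (n + m) k ⟩
  (n + m) C k + (n + m) C suc k                    ≤⟨ +-monoʳ-≤ ((n + m) C k) (C-shift-≤ n m k) ⟩
  (n + m) C k + (n C suc k + m * ((n + m) C k))    ≡⟨ regroup ((n + m) C k) (n C suc k) m ⟩
  n C suc k + suc m * ((n + m) C k)                ∎
  where
  open ≤-Reasoning
  regroup : ∀ x y m → x + (y + m * x) ≡ y + suc m * x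
  regroup = solve-∀

-- Each subset that is lost when an (n + 1)-set shrinks to n - m elements contains one of the m + 1
-- deleted elements. This makes `θ` of lower order than C(n, d).
C-∸-≤ : ∀ n m k → m ≤ n → suc n C suc k ∸ (n ∸ m) C suc k ≤ suc m * (n C k)
C-∸-≤ n m k m≤n = m≤n+o⇒m∸n≤o (suc n C suc k) ((n ∸ m) C suc k)
  (subst (λ z → suc z C suc k ≤ (n ∸ m) C suc k + suc m * (z C k)) (m∸n+n≡m m≤n) (C-step-≤ (n ∸ m) m k))

C-<-shift : ∀ y d → y C suc d < (suc y + suc d) C suc d
C-<-shift y d = begin-strict
  y C suc d                                          ≤⟨ C-monoˡ-≤ (suc d) (m≤m+n y (suc d)) ⟩
  (y + suc d) C suc d                                <⟨ m<n+m _ (≤-trans (≤-reflexive (sym (nCn≡1 d))) (C-monoˡ-≤ d (≤-trans (n≤1+n d) (m≤n+m (suc d) y)))) ⟩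
  (y + suc d) C d + (y + suc d) C suc d              ≡⟨ pascal (y + suc d) d ⟨
  (suc y + suc d) C suc d                            ∎
  where open ≤-Reasoning

-- With d = `suc e`, of the margin 2d one d pays for replacing C(n, d) by C(n + 1, d), the other is
-- the d in C(n, d + 1) / C(n, d) = (n - d) / (d + 1).
C-suc-* : ∀ n e t → t + 2 * suc e ≤ n → (suc n C suc e) * t ≤ 2+ e * (n C 2+ e)
C-suc-* n e t t+2d≤n = +-cancelʳ-≤ (d * Y) _ _ (begin
  (suc n C d) * t + d * Y      ≡⟨ cong (λ z → z * t + d * Y) (pascal n e) ⟩
  (X + Y) * t + d * Y        ≡⟨ regroup X Y t d ⟩
  t * X + (t + d) * Y        ≤⟨ +-monoˡ-≤ _ tX≤ ⟩
  d * Y + (t + d) * Y        ≡⟨ collect t d Y ⟩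
  (t + 2 * d) * Y            ≤⟨ *-monoˡ-≤ Y t+2d≤n ⟩
  n * Y                      ≡⟨ absorption n d ⟨
  suc d * (n C suc d) + d * Y ∎)
  where
  open ≤-Reasoning
  d = suc e
  X = n C e
  Y = n C d
  regroup : ∀ X Y t d → (X + Y) * t + d * Y ≡ t * X + (t + d) * Y
  regroup = solve-∀
  collect : ∀ t d Y → d * Y + (t + d) * Y ≡ (t + 2 * d) * Y
  collect = solve-∀
  tX≤ : t * X ≤ d * Y
  tX≤ = +-cancelʳ-≤ (e * X) _ _ (begin
    t * X + e * X      ≡⟨ *-distribʳ-+ X t e ⟨
    (t + e) * X        ≤⟨ *-monoˡ-≤ X (≤-trans (+-monoʳ-≤ t (≤-trans (n≤1+n e) (m≤m+n d (d + 0)))) t+2d≤n) ⟩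
    n * X              ≡⟨ absorption n e ⟨
    d * Y + e * X      ∎)

C-monoʳ-≤ : ∀ n k → suc (2 * k) ≤ n → n C k ≤ n C suc k
C-monoʳ-≤ n k 2k<n = *-cancelˡ-≤ (suc k) (+-cancelʳ-≤ (k * (n C k)) _ _ (begin
  suc k * (n C k) + k * (n C k)       ≡⟨ collect k (n C k) ⟩
  suc (2 * k) * (n C k)               ≤⟨ *-monoˡ-≤ (n C k) 2k<n ⟩
  n * (n C k)                         ≡⟨ absorption n k ⟨
  suc k * (n C suc k) + k * (n C k)   ∎))
  where
  open ≤-Reasoning
  collect : ∀ k a → suc k * a + k * a ≡ suc (2 * k) * a
  collect = solve-∀

*-^ : ∀ m n k → (m * n) ^ k ≡ m ^ k * n ^ k
*-^ m n zero    = refl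
*-^ m n (suc k) = trans (cong (m * n *_) (*-^ m n k)) (interchange m n (m ^ k) (n ^ k))
  where
  interchange : ∀ a b e f → a * b * (e * f) ≡ a * e * (b * f)
  interchange = solve-∀

-- The left side has degree less than d in c and the right side has degree d, so y can be as small
-- as c / L for any fixed L.
C-dominates : ∀ d K L .{{_ : NonZero L}} → ∃[ μ ] (∀ c → μ ≤ c →
  ∃[ y ] L * y ≤ c × (∀ j → j < d → K * (c C j) ≤ y C d))
C-dominates zero    K L = 0 , λ c _ → 0 , ≤-trans (≤-reflexive (*-zeroʳ L)) z≤n , λ _ ()
C-dominates (suc d) K L = (m₀ + suc d) * L , λ c μ≤c → c / L ,
  ≤-trans (≤-reflexive (*-comm L (c / L))) (m/n*n≤m c L) ,
  λ j j<1+d → bound c j (≤-pred j<1+d)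
    (≤-trans (≤-reflexive (sym (m*n/n≡m (m₀ + suc d) L))) (/-monoˡ-≤ L μ≤c))
    (≤-trans (≤-reflexive (m≡m%n+[m/n]*n c L)) (+-monoˡ-≤ _ (<⇒≤ (m%n<n c L))))
  where
  M  = suc d ! * (K * (2 * L) ^ d)
  -- For m = c / L - (d + 1), the summand `M` gives M * m ^ d ≤ m * m ^ d, and d + 2 turns c ≤ L *
  -- (m + d + 2) into c ≤ 2 * L * m.
  m₀ = M + suc (suc d)
  bound : ∀ c j → j ≤ d → m₀ + suc d ≤ c / L → c ≤ L + c / L * L → K * (c C j) ≤ (c / L) C suc d
  bound c j j≤d m₀+d<y c≤ with y ← c / L = *-cancelˡ-≤ (suc d !) {{suc d !≢0}} (begin
    suc d ! * (K * (c C j))                   ≤⟨ *-monoʳ-≤ (suc d !) (*-monoʳ-≤ K C≤) ⟩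
    suc d ! * (K * (2 * L * m) ^ d)           ≡⟨ cong (λ z → suc d ! * (K * z)) (*-^ (2 * L) m d) ⟩
    suc d ! * (K * ((2 * L) ^ d * m ^ d))     ≡⟨ regroup (suc d !) K ((2 * L) ^ d) (m ^ d) ⟩
    M * m ^ d                                 ≤⟨ *-monoˡ-≤ (m ^ d) (≤-trans (m≤m+n M _) m₀≤m) ⟩
    m * m ^ d                                 ≤⟨ ^≤!*C m (suc d) ⟩
    suc d ! * ((m + suc d) C suc d)           ≡⟨ cong (λ z → suc d ! * (z C suc d)) m+d≡y ⟩
    suc d ! * (y C suc d)                     ∎)
    where
    open ≤-Reasoning
    m = y ∸ suc d
    m+d≡y : m + suc d ≡ y
    m+d≡y = m∸n+n≡m (≤-trans (m≤n+m (suc d) m₀) m₀+d<y)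
    m₀≤m : m₀ ≤ m
    m₀≤m = +-cancelʳ-≤ (suc d) m₀ m (≤-trans m₀+d<y (≤-reflexive (sym m+d≡y)))
    regroup : ∀ a b e f → a * (b * (e * f)) ≡ a * (b * e) * f
    regroup = solve-∀
    c≤2Lm : c ≤ 2 * L * m
    c≤2Lm = begin
      c                            ≤⟨ c≤ ⟩
      L + y * L                    ≡⟨ cong (λ z → L + z * L) m+d≡y ⟨
      L + (m + suc d) * L          ≡⟨ lem L m d ⟩
      (m + suc (suc d)) * L        ≤⟨ *-monoˡ-≤ L (+-monoʳ-≤ m (≤-trans (m≤n+m _ M) m₀≤m)) ⟩
      (m + m) * L                  ≡⟨ lem′ L m ⟩
      2 * L * m                    ∎
      where
      lem : ∀ L m d → L + (m + suc d) * L ≡ (m + suc (suc d)) * L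
      lem = solve-∀
      lem′ : ∀ L m → (m + m) * L ≡ 2 * L * m
      lem′ = solve-∀
    1≤c′ : 1 ≤ 2 * L * m
    1≤c′ = *-mono-≤ (*-mono-≤ {1} {2} {1} {L} (s≤s z≤n) (>-nonZero⁻¹ L))
             (≤-trans (≤-trans (s≤s z≤n) (m≤n+m (suc (suc d)) M)) m₀≤m)
    C≤ : c C j ≤ (2 * L * m) ^ d
    C≤ = begin
      c C j                  ≤⟨ C≤^ c j ⟩
      c ^ j                  ≤⟨ ^-monoˡ-≤ j c≤2Lm ⟩
      (2 * L * m) ^ j        ≤⟨ ^-monoʳ-≤ (2 * L * m) {{>-nonZero 1≤c′}} j≤d ⟩
      (2 * L * m) ^ d        ∎

-- Cascades

-- Splits off the last term, because cascades are extended and cut at the top; `∑₁` splits off the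
-- first.
∑ : ℕ → (ℕ → ℕ) → ℕ
∑ zero    g = 0
∑ (suc n) g = ∑ n g + g (suc n)

∑-cong : ∀ n {g h : ℕ → ℕ} → (∀ i → i ≤ n → g i ≡ h i) → ∑ n g ≡ ∑ n h
∑-cong zero    eq = refl
∑-cong (suc n) eq = cong₂ _+_ (∑-cong n λ i i≤n → eq i (m≤n⇒m≤1+n i≤n)) (eq (suc n) ≤-refl)

∑-zero : ∀ n → ∑ n (λ _ → 0) ≡ 0
∑-zero zero    = refl
∑-zero (suc n) = trans (+-identityʳ _) (∑-zero n)

-- With c_d > … > c_1 these are the two sides of the Kruskal–Katona theorem: a
-- family of val d c sets of size d contains the full shadow of at most
-- val′ d c sets of size d + 1.
val val′ : ℕ → (ℕ → ℕ) → ℕ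
val  d c = ∑ d (λ i → c i C i)
val′ d c = ∑ d (λ i → c i C suc i)

infixl 6 _[_↦_]

_[_↦_] : (ℕ → ℕ) → ℕ → ℕ → (ℕ → ℕ)
(c [ j ↦ n ]) i with i ≟ j
... | yes _ = n
... | no  _ = c i

↦-here : ∀ c j n → (c [ j ↦ n ]) j ≡ n
↦-here c j n with j ≟ j
... | yes _  = refl
... | no j≢j = contradiction refl j≢j

↦-below : ∀ c {i j} n → i < j → (c [ j ↦ n ]) i ≡ c i
↦-below c {i} {j} n i<j with i ≟ j
... | yes refl = contradiction i<j (<-irrefl refl)
... | no  _    = refl

val-↦ : ∀ d c n → val (suc d) (c [ suc d ↦ n ]) ≡ val d c + n C suc d
val-↦ d c n = cong₂ _+_ (∑-cong d λ i i≤d → cong (_C i) (↦-below c n (s≤s i≤d)))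
                        (cong (_C suc d) (↦-here c (suc d) n))

val′-↦ : ∀ d c n → val′ (suc d) (c [ suc d ↦ n ]) ≡ val′ d c + n C suc (suc d)
val′-↦ d c n = cong₂ _+_ (∑-cong d λ i i≤d → cong (_C suc i) (↦-below c n (s≤s i≤d)))
                         (cong (_C suc (suc d)) (↦-here c (suc d) n))

C-pred : ∀ n k → n C suc k ≤ (n ∸ 1) C suc k + (n ∸ 1) C k
C-pred zero    k = z≤n
C-pred (suc n) k = ≤-reflexive (trans (pascal n k) (+-comm (n C k) (n C suc k)))

C-pred⁻ : ∀ n k → (n ∸ 1) C suc k + (n ∸ 1) C suc (suc k) ≤ n C suc (suc k)
C-pred⁻ zero    k = z≤n
C-pred⁻ (suc n) k = ≤-reflexive (sym (pascal n (suc k)))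

-- Pascal's rule in each term. In the Kruskal-Katona induction the two summands on the left bound
-- the link and the deletion of 𝒜.
pred-val : ∀ d (c : ℕ → ℕ) → val d (λ i → c i ∸ 1) + val′ d (λ i → c i ∸ 1) ≤ val′ d c
pred-val zero    c = z≤n
pred-val (suc d) c = begin
  (v + x) + (v′ + x′)   ≡⟨ interchange v x v′ x′ ⟩
  (v + v′) + (x + x′)   ≤⟨ +-mono-≤ (pred-val d c) (C-pred⁻ (c (suc d)) d) ⟩
  val′ (suc d) c        ∎
  where
  open ≤-Reasoning
  v  = val d (λ i → c i ∸ 1)
  v′ = val′ d (λ i → c i ∸ 1)
  x  = (c (suc d) ∸ 1) C suc d
  x′ = (c (suc d) ∸ 1) C suc (suc d)
  interchange : ∀ a b e f → (a + b) + (e + f) ≡ (a + e) + (b + f)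
  interchange = solve-∀

val′-shift : ∀ d (c : ℕ → ℕ) → val′ d (λ i → c (suc i) ∸ 1) ≤ val (suc d) (λ i → c i ∸ 1)
val′-shift zero    c = z≤n
val′-shift (suc d) c = +-monoˡ-≤ ((c (2+ d) ∸ 1) C 2+ d) (val′-shift d c)

-- Pascal's rule in each term; the term i = 1 leaves C(c_1 - 1, 0) = 1, hence the `suc`. In the
-- Kruskal-Katona induction this unit is matched by a strict inequality for `# ℬ₁`.
val-shift : ∀ d (c : ℕ → ℕ) → val (suc d) c ≤ suc (val (suc d) (λ i → c i ∸ 1) + val d (λ i → c (suc i) ∸ 1))
val-shift zero    c = ≤-trans (C-pred (c 1) 0) (≤-reflexive (lemma ((c 1 ∸ 1) C 1)))
  where
  lemma : ∀ a → a + 1 ≡ suc (a + 0)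
  lemma = solve-∀
val-shift (suc d) c = ≤-trans (+-mono-≤ (val-shift d c) (C-pred (c (2+ d)) (suc d)))
  (≤-reflexive (interchange (val (suc d) (λ i → c i ∸ 1)) (val d (λ i → c (suc i) ∸ 1)) _ _))
  where
  interchange : ∀ a b e f → suc (a + b) + (e + f) ≡ suc ((a + e) + (b + f))
  interchange = solve-∀

-- The first p sets of size d contain the full shadow of at most p (n - d) / (d + 1)
-- sets, with equality for all d-subsets of an n-set; here d is shifted by one.
average-cascade : ∀ d n p → p ≤ n C suc d → ∃[ c ]
  p ≤ val (suc d) c × val′ (suc d) c ≤ n C suc (suc d) ×
  suc (suc d) * val′ (suc d) c + suc d * p ≤ p * n
average-cascade zero n p p≤nC1 = (λ _ → p) , ≤-reflexive (sym (nC1≡n p)) , C-monoˡ-≤ 2 p≤n , (begin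
  2 * (p C 2) + 1 * p           ≡⟨ cong (λ z → 2 * (p C 2) + 1 * z) (nC1≡n p) ⟨
  2 * (p C 2) + 1 * (p C 1)     ≡⟨ absorption p 1 ⟩
  p * (p C 1)                   ≡⟨ cong (p *_) (nC1≡n p) ⟩
  p * p                         ≤⟨ *-monoʳ-≤ p p≤n ⟩
  p * n                         ∎)
  where
  open ≤-Reasoning
  p≤n : p ≤ n
  p≤n = ≤-trans p≤nC1 (≤-reflexive (nC1≡n n))
average-cascade (suc d) zero    .0 z≤n = (λ _ → 0) , z≤n ,
  ≤-reflexive (∑-zero (suc (suc d))) ,
  ≤-reflexive (trans (cong₂ _+_ (trans (cong (suc (suc (suc d)) *_) (∑-zero (suc (suc d)))) (*-zeroʳ (suc (suc (suc d))))) (*-zeroʳ (suc (suc d)))) refl)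
average-cascade (suc d) (suc n) p p≤ with p ≤? n C suc (suc d)
... | yes p≤′ =
  let c , p≤val , val′≤ , avg = average-cascade (suc d) n p p≤′
  in  c , p≤val , ≤-trans val′≤ (C-suc-≤ n (suc (suc (suc d)))) , ≤-trans avg (*-monoʳ-≤ p (n≤1+n n))
... | no p≰ =
  let c , j≤val , val′≤ , avg = average-cascade d n j j≤
  in  c [ suc (suc d) ↦ n ] ,
      subst₂ _≤_ j+X≡p (sym (val-↦ (suc d) c n)) (+-monoˡ-≤ X j≤val) ,
      subst₂ _≤_ (sym (val′-↦ (suc d) c n)) (sym (pascal n (suc (suc d)))) (+-monoˡ-≤ W val′≤) ,
      subst (λ z → 3+ d * z + suc (suc d) * p ≤ p * suc n) (sym (val′-↦ (suc d) c n))
        (subst (λ z → 3+ d * (val′ (suc d) c + W) + suc (suc d) * z ≤ z * suc n) j+X≡p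
          (final (val′ (suc d) c) val′≤ avg))
  where
  open ≤-Reasoning
  3+ : ℕ → ℕ
  3+ d = suc (suc (suc d))
  X = n C suc (suc d)
  W = n C suc (suc (suc d))
  j = p ∸ X
  j+X≡p : j + X ≡ p
  j+X≡p = m∸n+n≡m (≰⇒≥ p≰)
  j≤ : j ≤ n C suc d
  j≤ = +-cancelʳ-≤ X j (n C suc d)
         (≤-trans (≤-reflexive j+X≡p) (≤-trans p≤ (≤-reflexive (pascal n (suc d)))))
  -- The lower level has the coefficient d + 2 where d + 3 is needed. The extra v is absorbed by v ≤
  -- X, which is why the bound on `val′` is carried through the induction.
  final : ∀ v → v ≤ X → suc (suc d) * v + suc d * j ≤ j * n →
          3+ d * (v + W) + suc (suc d) * (j + X) ≤ (j + X) * suc n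
  final v v≤X avg = begin
    3+ d * (v + W) + suc (suc d) * (j + X)
      ≡⟨ regroup d v W j X ⟩
    (suc (suc d) * v + suc d * j) + v + j + (3+ d * W + suc (suc d) * X)
      ≤⟨ +-mono-≤ (+-monoˡ-≤ j (+-mono-≤ avg v≤X)) (≤-reflexive (absorption n (suc (suc d)))) ⟩
    j * n + X + j + n * X
      ≡⟨ collect j n X ⟩
    (j + X) * suc n ∎
    where
    regroup : ∀ d v W j X → suc (suc (suc d)) * (v + W) + suc (suc d) * (j + X) ≡
      (suc (suc d) * v + suc d * j) + v + j + (suc (suc (suc d)) * W + suc (suc d) * X)
    regroup = solve-∀
    collect : ∀ j n X → j * n + X + j + n * X ≡ (j + X) * suc n
    collect = solve-∀

val<C : ∀ d (c : ℕ → ℕ) → (∀ i j → 1 ≤ i → i < j → j ≤ suc d → c i < c j) →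
        val (suc d) c ≤ suc (c (suc d)) C suc d
val<C zero    c c-mono = C-suc-≤ (c 1) 1
val<C (suc d) c c-mono = begin
  val (suc d) c + c (2+ d) C 2+ d             ≤⟨ +-monoˡ-≤ (c (2+ d) C 2+ d) (val<C d c λ i j 1≤i i<j j≤ → c-mono i j 1≤i i<j (m≤n⇒m≤1+n j≤)) ⟩
  suc (c (suc d)) C suc d + c (2+ d) C 2+ d   ≤⟨ +-monoˡ-≤ (c (2+ d) C 2+ d) (C-monoˡ-≤ (suc d) (c-mono (suc d) (2+ d) (s≤s z≤n) ≤-refl ≤-refl)) ⟩
  c (2+ d) C suc d + c (2+ d) C 2+ d          ≡⟨ pascal (c (2+ d)) (suc d) ⟨
  suc (c (2+ d)) C 2+ d                       ∎
  where open ≤-Reasoning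

-- Removing S sets from a cascade with large entries lowers the
-- Kruskal–Katona bound by at least any `lost` of order S ^ (1 + 1 / d).
module Cut (d E S lost : ℕ) (c : ℕ → ℕ)
  (c-mono    : ∀ i j → 1 ≤ i → i < j → j ≤ d → c i < c j)
  (c-large   : ∀ i → 1 ≤ i → i ≤ d → 2 * (d + 4 * E) + 2 ≤ c i)
  (lost-≤    : ∀ y → S ≤ y C d → suc d * lost ≤ S * (y + E))
  (fits-below : ∀ i → 1 ≤ i → i < d → ∃[ y ] 8 * y ≤ c i × 4 * (c i C i) ≤ y C d)
  (fits-top  : ∃[ y ] 8 * y ≤ c d × S ≤ y C d)
  where

  open ≤-Reasoning

  private
    -- One half of x pays for 4 * y and the other half for d + 4 * E; hence the factors 8 and 2 in
    -- the assumptions on c.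
    slack : ∀ y x → 8 * y ≤ x → 2 * (d + 4 * E) + 2 ≤ x → d + 4 * (y + E) ≤ x
    slack y x 8y≤x large = *-cancelˡ-≤ 2 (begin
      2 * (d + 4 * (y + E))                ≡⟨ regroup d y E ⟩
      8 * y + 2 * (d + 4 * E)              ≤⟨ +-mono-≤ 8y≤x (≤-trans (m≤m+n _ 2) large) ⟩
      x + x                                ≡⟨ double x ⟩
      2 * x                                ∎)
      where
      regroup : ∀ d y E → 2 * (d + 4 * (y + E)) ≡ 8 * y + 2 * (d + 4 * E)
      regroup = solve-∀
      double : ∀ x → x + x ≡ 2 * x
      double = solve-∀

    nothing-lost : S ≤ 0 → lost ≤ 0
    nothing-lost S≤0 = *-cancelˡ-≤ (suc d) (begin
      suc d * lost         ≤⟨ lost-≤ 0 (≤-trans S≤0 z≤n) ⟩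
      S * (0 + E)          ≡⟨ cong (_* (0 + E)) (n≤0⇒n≡0 S≤0) ⟩
      0                    ≤⟨ z≤n ⟩
      suc d * 0            ∎)

    val≤2C : ∀ e → suc e ≤ d → val (suc e) c ≤ 2 * (c (suc e) C suc e)
    val≤2C e e<d = begin
      val (suc e) c                                ≤⟨ val<C e c (λ i j 1≤i i<j j≤ → c-mono i j 1≤i i<j (≤-trans j≤ e<d)) ⟩
      suc (c (suc e)) C suc e                      ≡⟨ pascal (c (suc e)) e ⟩
      c (suc e) C e + c (suc e) C suc e            ≤⟨ +-monoˡ-≤ _ (C-monoʳ-≤ (c (suc e)) e 2e<) ⟩
      c (suc e) C suc e + c (suc e) C suc e        ≡⟨ double (c (suc e) C suc e) ⟩
      2 * (c (suc e) C suc e)                      ∎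
      where
      double : ∀ x → x + x ≡ 2 * x
      double = solve-∀
      2e< : suc (2 * e) ≤ c (suc e)
      2e< = begin
        suc (2 * e)               ≤⟨ s≤s (*-monoʳ-≤ 2 (≤-trans (≤-trans (n≤1+n e) e<d) (m≤m+n d (4 * E)))) ⟩
        suc (2 * (d + 4 * E))     ≤⟨ ≤-trans (n≤1+n _) (≤-reflexive (+-comm 2 _)) ⟩
        2 * (d + 4 * E) + 2       ≤⟨ c-large (suc e) (s≤s z≤n) e<d ⟩
        c (suc e)                 ∎

    -- With x = `c (suc e)`, S is at most of order x^(e+1), so `lost` is at most of order
    -- x^((e+1)(1+1/d)). This exponent is below e + 2 because e + 1 < d, so a single term of `val′`
    -- suffices.
    lower-level : ∀ e → suc e < d → S ≤ 2 * val (suc e) c → lost ≤ val′ (suc e) c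
    lower-level e e<d S≤ with fits-below (suc e) (s≤s z≤n) e<d
    ... | y , 8y≤x , 4X≤ = ≤-trans (*-cancelˡ-≤ (suc d) (begin
      suc d * lost            ≤⟨ lost-≤ y (≤-trans S≤4X 4X≤) ⟩
      S * (y + E)             ≤⟨ *-monoˡ-≤ (y + E) S≤4X ⟩
      4 * X * (y + E)         ≤⟨ +-cancelʳ-≤ (suc e * X) _ _ step ⟩
      2+ e * W                ≤⟨ *-monoˡ-≤ W (≤-trans e<d (n≤1+n d)) ⟩
      suc d * W               ∎)) (m≤n+m W (val′ e c))
      where
      x = c (suc e)
      X = x C suc e
      W = x C 2+ e
      S≤4X : S ≤ 4 * X
      S≤4X = ≤-trans S≤ (≤-trans (*-monoʳ-≤ 2 (val≤2C e (<⇒≤ e<d))) (≤-reflexive (sym (*-assoc 2 2 X))))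
      step : 4 * X * (y + E) + suc e * X ≤ 2+ e * W + suc e * X
      step = begin
        4 * X * (y + E) + suc e * X      ≡⟨ regroup X (y + E) (suc e) ⟩
        (suc e + 4 * (y + E)) * X        ≤⟨ *-monoˡ-≤ X (+-monoˡ-≤ _ (<⇒≤ e<d)) ⟩
        (d + 4 * (y + E)) * X            ≤⟨ *-monoˡ-≤ X (slack y x 8y≤x (c-large (suc e) (s≤s z≤n) (<⇒≤ e<d))) ⟩
        x * X                            ≡⟨ absorption x (suc e) ⟨
        2+ e * W + suc e * X             ∎
        where
        regroup : ∀ X z e → 4 * X * z + e * X ≡ (e + 4 * z) * X
        regroup = solve-∀

    scale : ∀ e s → suc e ≤ d → S ≤ 2 * s → s ≤ c (suc e) C suc e →
            ∃[ y ] 8 * y ≤ c (suc e) × S ≤ y C d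
    scale e s e<d S≤ s≤ with m≤n⇒m<n∨m≡n e<d
    ... | inj₂ refl = fits-top
    ... | inj₁ e<d′ =
      let y , 8y≤ , 4X≤ = fits-below (suc e) (s≤s z≤n) e<d′
      in  y , 8y≤ , ≤-trans S≤ (≤-trans (*-mono-≤ (s≤s (s≤s (z≤n {2}))) s≤) 4X≤)

    same-level : ∀ e s → suc e ≤ d → S ≤ 2 * s → s ≤ c (suc e) C suc e →
                 2+ e * lost + suc e * s ≤ s * c (suc e)
    same-level e s e<d S≤ s≤ with scale e s e<d S≤ s≤
    ... | y , 8y≤x , S≤C = begin
      2+ e * lost + suc e * s               ≤⟨ +-monoˡ-≤ (suc e * s) (*-monoˡ-≤ lost (s≤s e<d)) ⟩
      suc d * lost + suc e * s              ≤⟨ +-monoˡ-≤ (suc e * s) (lost-≤ y S≤C) ⟩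
      S * (y + E) + suc e * s               ≤⟨ +-mono-≤ (*-monoˡ-≤ (y + E) (≤-trans S≤ (*-monoˡ-≤ s (s≤s (s≤s (z≤n {2})))))) (*-monoˡ-≤ s e<d) ⟩
      4 * s * (y + E) + d * s               ≡⟨ regroup s (y + E) d ⟩
      s * (d + 4 * (y + E))                 ≤⟨ *-monoʳ-≤ s (slack y x 8y≤x (c-large (suc e) (s≤s z≤n) e<d)) ⟩
      s * x                                 ∎
      where
      x = c (suc e)
      regroup : ∀ s z d → 4 * s * z + d * s ≡ s * (d + 4 * z)
      regroup = solve-∀

  -- If S fits into the lower terms, they are cut recursively. Otherwise they all go, together with
  -- s sets of the top block, and `average-cascade` rearranges the p sets left there. The larger
  -- part of S = val e c + s pays for `lost`: the lower terms through the disappearance of val′ e c,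
  -- or s through the drop of the average bound on the top block.
  cut : ∀ e → e ≤ d → S ≤ val e c →
        ∃[ c̃ ] val e c ≤ val e c̃ + S × val′ e c̃ + lost ≤ val′ e c
  cut zero e≤d S≤0 = c , z≤n , nothing-lost S≤0
  cut (suc e) e<d S≤ with S ≤? val e c
  ... | yes S≤val =
    let c̃ , size , gain = cut e (<⇒≤ e<d) S≤val
    in  c̃ [ suc e ↦ x ] ,
        (begin
          val e c + X                              ≤⟨ +-monoˡ-≤ X size ⟩
          val e c̃ + S + X                          ≡⟨ swap (val e c̃) S X ⟩
          val e c̃ + X + S                          ≡⟨ cong (_+ S) (val-↦ e c̃ x) ⟨
          val (suc e) (c̃ [ suc e ↦ x ]) + S        ∎) ,
        (begin
          val′ (suc e) (c̃ [ suc e ↦ x ]) + lost    ≡⟨ cong (_+ lost) (val′-↦ e c̃ x) ⟩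
          val′ e c̃ + W + lost                      ≡⟨ swap (val′ e c̃) W lost ⟩
          val′ e c̃ + lost + W                      ≤⟨ +-monoˡ-≤ W gain ⟩
          val′ (suc e) c                           ∎)
    where
    x = c (suc e)
    X = x C suc e
    W = x C 2+ e
    swap : ∀ a b e → a + b + e ≡ a + e + b
    swap = solve-∀
  ... | no S≰val =
    let c̃ , size , top , avg = average-cascade e x p (m∸n≤m X s)
    in  c̃ ,
        (begin
          val e c + X                    ≡⟨ cong (val e c +_) p+s≡X ⟨
          val e c + (p + s)              ≡⟨ swap (val e c) p s ⟩
          p + (val e c + s)              ≡⟨ cong (p +_) val+s≡S ⟩
          p + S                          ≤⟨ +-monoˡ-≤ S size ⟩
          val (suc e) c̃ + S              ∎) ,
        gain (val′ (suc e) c̃) top avg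
    where
    x = c (suc e)
    X = x C suc e
    W = x C 2+ e
    s = S ∸ val e c
    p = X ∸ s
    val+s≡S : val e c + s ≡ S
    val+s≡S = m+[n∸m]≡n (≰⇒≥ S≰val)
    s≤X : s ≤ X
    s≤X = +-cancelˡ-≤ (val e c) s X (≤-trans (≤-reflexive val+s≡S) S≤)
    p+s≡X : p + s ≡ X
    p+s≡X = m∸n+n≡m s≤X
    swap : ∀ a p s → a + (p + s) ≡ p + (a + s)
    swap = solve-∀
    double : ∀ x → x + x ≡ 2 * x
    double = solve-∀
    gain : ∀ v → v ≤ W → 2+ e * v + suc e * p ≤ p * x → v + lost ≤ val′ e c + W
    gain v v≤W avg with s ≤? val e c
    ... | yes s≤val = begin
      v + lost       ≤⟨ +-mono-≤ v≤W (lost≤val′ e e<d (begin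
        S                  ≡⟨ val+s≡S ⟨
        val e c + s        ≤⟨ +-monoʳ-≤ (val e c) s≤val ⟩
        val e c + val e c  ≡⟨ double (val e c) ⟩
        2 * val e c        ∎)) ⟩
      W + val′ e c   ≡⟨ +-comm W (val′ e c) ⟩
      val′ e c + W   ∎
      where
      lost≤val′ : ∀ e → suc e ≤ d → S ≤ 2 * val e c → lost ≤ val′ e c
      lost≤val′ zero    e<d S≤0 = nothing-lost S≤0
      lost≤val′ (suc e) e<d S≤′ = lower-level e e<d S≤′
    ... | no s≰val = ≤-trans (*-cancelˡ-≤ (2+ e) (+-cancelʳ-≤ (suc e * X) _ _ (begin
      2+ e * (v + lost) + suc e * X                           ≡⟨ cong (λ z → 2+ e * (v + lost) + suc e * z) p+s≡X ⟨
      2+ e * (v + lost) + suc e * (p + s)                     ≡⟨ regroup e v lost p s ⟩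
      (2+ e * v + suc e * p) + (2+ e * lost + suc e * s)      ≤⟨ +-mono-≤ avg (same-level e s e<d S≤2s s≤X) ⟩
      p * x + s * x                                           ≡⟨ collect p s x ⟩
      x * (p + s)                                             ≡⟨ cong (x *_) p+s≡X ⟩
      x * X                                                   ≡⟨ absorption x (suc e) ⟨
      2+ e * W + suc e * X                                    ∎))) (m≤n+m W (val′ e c))
      where
      regroup : ∀ e v l p s → suc (suc e) * (v + l) + suc e * (p + s) ≡
                (suc (suc e) * v + suc e * p) + (suc (suc e) * l + suc e * s)
      regroup = solve-∀
      collect : ∀ p s x → p * x + s * x ≡ x * (p + s)
      collect = solve-∀
      S≤2s : S ≤ 2 * s
      S≤2s = begin
        S              ≡⟨ val+s≡S ⟨
        val e c + s    ≤⟨ +-monoˡ-≤ s (≰⇒≥ s≰val) ⟩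
        s + s          ≡⟨ double s ⟩
        2 * s          ∎

-- Families on a finite ground set

⟦_⟧ : Bool → ℕ
⟦ false ⟧ = 0
⟦ true  ⟧ = 1

⟦⟧≤1 : ∀ b → ⟦ b ⟧ ≤ 1
⟦⟧≤1 false = z≤n
⟦⟧≤1 true  = ≤-refl

-- Families of subsets of {0, …, N - 1}.
𝔽 : ℕ → Set
𝔽 N = Vec Bool N → Bool

ins : Fin (suc N) → Bool → Vec Bool N → Vec Bool (suc N)
ins v b y = insertAt y v b

link del : Fin (suc N) → 𝔽 (suc N) → 𝔽 N
link v 𝒜 = 𝒜 ∘ ins v true
del  v 𝒜 = 𝒜 ∘ ins v false

∑ᶜ : ∀ N → (Vec Bool N → ℕ) → ℕ
∑ᶜ zero    g = g []
∑ᶜ (suc N) g = ∑ᶜ N (g ∘ (true ∷_)) + ∑ᶜ N (g ∘ (false ∷_))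

# : 𝔽 N → ℕ
# {N} 𝒜 = ∑ᶜ N (λ x → ⟦ 𝒜 x ⟧)

∑ᶜ-mono : ∀ N {g h : Vec Bool N → ℕ} → (∀ x → g x ≤ h x) → ∑ᶜ N g ≤ ∑ᶜ N h
∑ᶜ-mono zero    g≤h = g≤h []
∑ᶜ-mono (suc N) g≤h = +-mono-≤ (∑ᶜ-mono N (g≤h ∘ (true ∷_))) (∑ᶜ-mono N (g≤h ∘ (false ∷_)))

∑ᶜ-cong : ∀ N {g h : Vec Bool N → ℕ} → (∀ x → g x ≡ h x) → ∑ᶜ N g ≡ ∑ᶜ N h
∑ᶜ-cong N g≡h = ≤-antisym (∑ᶜ-mono N (≤-reflexive ∘ g≡h)) (∑ᶜ-mono N (≤-reflexive ∘ sym ∘ g≡h))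

+-interchange : ∀ a b c d → (a + b) + (c + d) ≡ (a + c) + (b + d)
+-interchange = solve-∀

∑ᶜ-+ : ∀ N (g h : Vec Bool N → ℕ) → ∑ᶜ N (λ x → g x + h x) ≡ ∑ᶜ N g + ∑ᶜ N h
∑ᶜ-+ zero    g h = refl
∑ᶜ-+ (suc N) g h = trans (cong₂ _+_ (∑ᶜ-+ N _ _) (∑ᶜ-+ N _ _))
  (+-interchange (∑ᶜ N (g ∘ (true ∷_))) (∑ᶜ N (h ∘ (true ∷_))) (∑ᶜ N (g ∘ (false ∷_))) (∑ᶜ N (h ∘ (false ∷_))))

∑ᶜ-* : ∀ N k (g : Vec Bool N → ℕ) → ∑ᶜ N (λ x → k * g x) ≡ k * ∑ᶜ N g
∑ᶜ-* zero    k g = refl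
∑ᶜ-* (suc N) k g = trans (cong₂ _+_ (∑ᶜ-* N k _) (∑ᶜ-* N k _))
  (sym (*-distribˡ-+ k (∑ᶜ N (g ∘ (true ∷_))) (∑ᶜ N (g ∘ (false ∷_)))))

∑ᶜ-zero : ∀ N {g : Vec Bool N → ℕ} → (∀ x → g x ≡ 0) → ∑ᶜ N g ≡ 0
∑ᶜ-zero N {g} g≡0 = trans (∑ᶜ-cong N {h = λ x → 0 * g x} g≡0) (∑ᶜ-* N 0 g)

∑ᶜ-split : ∀ (v : Fin (suc N)) (g : Vec Bool (suc N) → ℕ) →
           ∑ᶜ (suc N) g ≡ ∑ᶜ N (g ∘ ins v true) + ∑ᶜ N (g ∘ ins v false)
∑ᶜ-split           zero    g = refl
∑ᶜ-split {suc N} (suc v) g = trans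
  (cong₂ _+_ (∑ᶜ-split v (g ∘ (true ∷_))) (∑ᶜ-split v (g ∘ (false ∷_))))
  (+-interchange (∑ᶜ N (g ∘ (true ∷_) ∘ ins v true)) (∑ᶜ N (g ∘ (true ∷_) ∘ ins v false))
                 (∑ᶜ N (g ∘ (false ∷_) ∘ ins v true)) (∑ᶜ N (g ∘ (false ∷_) ∘ ins v false)))

#-split : ∀ (v : Fin (suc N)) 𝒜 → # 𝒜 ≡ # (link v 𝒜) + # (del v 𝒜)
#-split v 𝒜 = ∑ᶜ-split v (λ x → ⟦ 𝒜 x ⟧)

#-mono : ∀ {𝒜 ℬ : 𝔽 N} → (∀ x → 𝒜 x ≡ true → ℬ x ≡ true) → # 𝒜 ≤ # ℬ
#-mono {N} {𝒜} {ℬ} 𝒜⊆ℬ = ∑ᶜ-mono N bound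
  where
  bound : ∀ x → ⟦ 𝒜 x ⟧ ≤ ⟦ ℬ x ⟧
  bound x with 𝒜 x in eq
  ... | false = z≤n
  ... | true  rewrite 𝒜⊆ℬ x eq = ≤-refl

#≡0 : ∀ (𝒜 : 𝔽 N) → (∀ x → 𝒜 x ≢ true) → # 𝒜 ≡ 0
#≡0 {N} 𝒜 empty = ∑ᶜ-zero N vanish
  where
  vanish : ∀ x → ⟦ 𝒜 x ⟧ ≡ 0
  vanish x with 𝒜 x in eq
  ... | false = refl
  ... | true  = contradiction eq (empty x)

-- The number of members of ℬ of the form x - v.
τ : 𝔽 N → Vec Bool N → ℕ
τ ℬ []          = 0
τ ℬ (true  ∷ y) = ⟦ ℬ (false ∷ y) ⟧ + τ (ℬ ∘ (true ∷_)) y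
τ ℬ (false ∷ y) = τ (ℬ ∘ (false ∷_)) y

size : Vec Bool N → ℕ
size []          = 0
size (true  ∷ y) = suc (size y)
size (false ∷ y) = size y

size-ins-true : ∀ (v : Fin (suc N)) y → size (ins v true y) ≡ suc (size y)
size-ins-true zero    y           = refl
size-ins-true (suc v) (true  ∷ y) = cong suc (size-ins-true v y)
size-ins-true (suc v) (false ∷ y) = size-ins-true v y

size-ins-false : ∀ (v : Fin (suc N)) y → size (ins v false y) ≡ size y
size-ins-false zero    y           = refl
size-ins-false (suc v) (true  ∷ y) = cong suc (size-ins-false v y)
size-ins-false (suc v) (false ∷ y) = size-ins-false v y

-- The subset that omits v lies in the deletion; all others contain v and survive in the link.
τ-ins-true : ∀ (v : Fin (suc N)) ℬ y →
             τ ℬ (ins v true y) ≡ ⟦ del v ℬ y ⟧ + τ (link v ℬ) y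
τ-ins-true zero    ℬ y           = refl
τ-ins-true (suc v) ℬ (true  ∷ y) = trans
  (cong (⟦ ℬ (false ∷ ins v true y) ⟧ +_) (τ-ins-true v (ℬ ∘ (true ∷_)) y))
  (x∙yz≈y∙xz ⟦ ℬ (false ∷ ins v true y) ⟧ ⟦ ℬ (true ∷ ins v false y) ⟧ _)
  where
  x∙yz≈y∙xz : ∀ a b c → a + (b + c) ≡ b + (a + c)
  x∙yz≈y∙xz = solve-∀
τ-ins-true (suc v) ℬ (false ∷ y) = τ-ins-true v (ℬ ∘ (false ∷_)) y

τ-ins-false : ∀ (v : Fin (suc N)) ℬ y → τ ℬ (ins v false y) ≡ τ (del v ℬ) y
τ-ins-false zero    ℬ y           = refl
τ-ins-false (suc v) ℬ (true  ∷ y) =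
  cong (⟦ ℬ (false ∷ ins v false y) ⟧ +_) (τ-ins-false v (ℬ ∘ (true ∷_)) y)
τ-ins-false (suc v) ℬ (false ∷ y) = τ-ins-false v (ℬ ∘ (false ∷_)) y

Covered : ℕ → 𝔽 N → 𝔽 N → Set
Covered k 𝒜 ℬ = ∀ x → 𝒜 x ≡ true → k ≤ τ ℬ x

infixl 6 _∖_

_∖_ : 𝔽 N → 𝔽 N → 𝔽 N
(𝒜 ∖ ℬ) x = 𝒜 x ∧ not (ℬ x)

module _ {k N : ℕ} (v : Fin (suc N)) {𝒜 ℬ : 𝔽 (suc N)} where

  covered-del : Covered k 𝒜 ℬ → Covered k (del v 𝒜) (del v ℬ)
  covered-del cov y y∈ = subst (k ≤_) (τ-ins-false v ℬ y) (cov _ y∈)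

  covered-link : Covered (suc k) 𝒜 ℬ → Covered k (link v 𝒜) (link v ℬ)
  covered-link cov y y∈ = ≤-pred (begin
    suc k                               ≤⟨ cov _ y∈ ⟩
    τ ℬ (ins v true y)                  ≡⟨ τ-ins-true v ℬ y ⟩
    ⟦ del v ℬ y ⟧ + τ (link v ℬ) y      ≤⟨ +-monoˡ-≤ _ (⟦⟧≤1 (del v ℬ y)) ⟩
    suc (τ (link v ℬ) y)                ∎)
    where open ≤-Reasoning

  covered-link∖del : Covered k 𝒜 ℬ → Covered k (link v 𝒜 ∖ del v ℬ) (link v ℬ)
  covered-link∖del cov y y∈ with link v 𝒜 y in y∈𝒜 | del v ℬ y in y∉ℬ
  ... | true | false = subst (k ≤_) (trans (τ-ins-true v ℬ y) (cong (λ b → ⟦ b ⟧ + τ (link v ℬ) y) y∉ℬ)) (cov _ y∈𝒜)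

#-∖ : ∀ (𝒜 ℬ : 𝔽 N) → # 𝒜 ≤ # (𝒜 ∖ ℬ) + # ℬ
#-∖ {N} 𝒜 ℬ = ≤-trans (∑ᶜ-mono N bound) (≤-reflexive (∑ᶜ-+ N _ _))
  where
  bound : ∀ x → ⟦ 𝒜 x ⟧ ≤ ⟦ 𝒜 x ∧ not (ℬ x) ⟧ + ⟦ ℬ x ⟧
  bound x with 𝒜 x | ℬ x
  ... | false | _     = z≤n
  ... | true  | false = ≤-refl
  ... | true  | true  = ≤-refl

-- A crude upper bound by induction on the ground set

#≡0-[] : ∀ {k} {𝒜 ℬ : 𝔽 0} → Covered (suc k) 𝒜 ℬ → # 𝒜 ≡ 0
#≡0-[] {𝒜 = 𝒜} cov = #≡0 𝒜 λ { [] []∈ → contradiction (cov [] []∈) λ () }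

-- Let p and q be the sizes of the link and the deletion of ℬ at the first element v. If p is small,
-- the link is handled with d - 1, as it is covered at most once less. If p is large, Pascal's rule
-- puts q below the threshold for y - 1, and the q saved there pays for the sets A with A - v in ℬ.
-- For all d-subsets of a (y + d)-set the bound is too large by the factor d + 1.
crude-bound : ∀ N d y (𝒜 ℬ : 𝔽 N) → Covered (suc d) 𝒜 ℬ →
              # ℬ < (suc y + d) C d → # 𝒜 ≤ # ℬ * y
crude-bound zero    d y 𝒜 ℬ cov _ rewrite #≡0-[] {𝒜 = 𝒜} {ℬ} cov = z≤n
crude-bound (suc N) zero y 𝒜 ℬ cov b<1 = begin
  # 𝒜                                                ≡⟨ #-split zero 𝒜 ⟩
  # (link zero 𝒜) + # (del zero 𝒜)                   ≤⟨ +-mono-≤ (#-∖ (link zero 𝒜) (del zero ℬ))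
      (crude-bound N 0 y _ _ (covered-del zero {𝒜} {ℬ} cov) (≤-<-trans q≤ b<1)) ⟩
  # (link zero 𝒜 ∖ del zero ℬ) + q + q * y           ≤⟨ +-monoˡ-≤ (q * y) (+-monoˡ-≤ q
      (crude-bound N 0 y _ _ (covered-link∖del zero {𝒜} {ℬ} cov) (≤-<-trans p≤ b<1))) ⟩
  p * y + q + q * y                                  ≡⟨ cong (λ z → p * y + z + q * y) q≡0 ⟩
  p * y + 0 + q * y                                  ≡⟨ collect p q y ⟩
  (p + q) * y                                        ≡⟨ cong (_* y) (#-split zero ℬ) ⟨
  # ℬ * y                                            ∎
  where
  open ≤-Reasoning
  p = # (link zero ℬ)
  q = # (del zero ℬ)
  p≤ : p ≤ # ℬ
  p≤ = ≤-trans (m≤m+n p q) (≤-reflexive (sym (#-split zero ℬ)))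
  q≤ : q ≤ # ℬ
  q≤ = ≤-trans (m≤n+m q p) (≤-reflexive (sym (#-split zero ℬ)))
  q≡0 : q ≡ 0
  q≡0 = n<1⇒n≡0 (≤-<-trans q≤ b<1)
  collect : ∀ p q y → p * y + 0 + q * y ≡ (p + q) * y
  collect = solve-∀
crude-bound (suc N) (suc d) y 𝒜 ℬ cov b< with # (link zero ℬ) <? (suc y + d) C d
... | yes p< = begin
  # 𝒜                                   ≡⟨ #-split zero 𝒜 ⟩
  # (link zero 𝒜) + # (del zero 𝒜)      ≤⟨ +-mono-≤
      (crude-bound N d y _ _ (covered-link zero {𝒜} {ℬ} cov) p<)
      (crude-bound N (suc d) y _ _ (covered-del zero {𝒜} {ℬ} cov) (≤-<-trans q≤ b<)) ⟩
  p * y + q * y                         ≡⟨ *-distribʳ-+ y p q ⟨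
  (p + q) * y                           ≡⟨ cong (_* y) (#-split zero ℬ) ⟨
  # ℬ * y                               ∎
  where
  open ≤-Reasoning
  p = # (link zero ℬ)
  q = # (del zero ℬ)
  q≤ : q ≤ # ℬ
  q≤ = ≤-trans (m≤n+m q p) (≤-reflexive (sym (#-split zero ℬ)))
... | no p≮ = begin
  # 𝒜                                                   ≡⟨ #-split zero 𝒜 ⟩
  # (link zero 𝒜) + # (del zero 𝒜)                      ≤⟨ +-monoˡ-≤ _ (#-∖ (link zero 𝒜) (del zero ℬ)) ⟩
  # (link zero 𝒜 ∖ del zero ℬ) + q + # (del zero 𝒜)     ≤⟨ +-monoˡ-≤ _ (+-monoˡ-≤ q
      (crude-bound N (suc d) y _ _ (covered-link∖del zero {𝒜} {ℬ} cov) (≤-<-trans p≤ b<))) ⟩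
  p * y + q + # (del zero 𝒜)                            ≤⟨ part y q< ⟩
  p * y + q * y                                         ≡⟨ *-distribʳ-+ y p q ⟨
  (p + q) * y                                           ≡⟨ cong (_* y) (#-split zero ℬ) ⟨
  # ℬ * y                                               ∎
  where
  open ≤-Reasoning
  p = # (link zero ℬ)
  q = # (del zero ℬ)
  p≤ : p ≤ # ℬ
  p≤ = ≤-trans (m≤m+n p q) (≤-reflexive (sym (#-split zero ℬ)))
  q< : q < (y + suc d) C suc d
  q< = +-cancelˡ-< p q _ (<-≤-trans (subst (_< (suc y + suc d) C suc d) (#-split zero ℬ) b<)
    (≤-trans (≤-reflexive (pascal (y + suc d) d))
      (+-monoˡ-≤ _ (≤-trans (≤-reflexive (cong (_C d) (+-suc y d))) (≮⇒≥ p≮)))))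
  part : ∀ y → q < (y + suc d) C suc d → p * y + q + # (del zero 𝒜) ≤ p * y + q * y
  -- There is no y - 1 here, but the threshold for y = 0 forces q = 0.
  part zero q<1 = begin
    p * 0 + q + # (del zero 𝒜)
      ≤⟨ +-monoʳ-≤ (p * 0 + q) (crude-bound N (suc d) 0 _ _ (covered-del zero {𝒜} {ℬ} cov)
           (<-≤-trans q<1 (C-suc-≤ (suc d) (suc d)))) ⟩
    p * 0 + q + q * 0      ≡⟨ cong (λ z → p * 0 + z + q * 0) (n<1⇒n≡0 (<-≤-trans q<1 (≤-reflexive (nCn≡1 (suc d))))) ⟩
    p * 0 + 0 + q * 0      ≡⟨ cong (_+ q * 0) (+-identityʳ (p * 0)) ⟩
    p * 0 + q * 0          ∎
  part (suc y) q< = begin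
    p * suc y + q + # (del zero 𝒜)
      ≤⟨ +-monoʳ-≤ (p * suc y + q) (crude-bound N (suc d) y _ _ (covered-del zero {𝒜} {ℬ} cov) q<) ⟩
    p * suc y + q + q * y  ≡⟨ collect p q y ⟩
    p * suc y + q * suc y  ∎
    where
    collect : ∀ p q y → p * suc y + q + q * y ≡ p * suc y + q * suc y
    collect = solve-∀

-- The Kruskal–Katona theorem

∧⁻ : ∀ {a b} → a ∧ b ≡ true → a ≡ true × b ≡ true
∧⁻ {true} {true} _ = refl , refl

∨⁻ : ∀ {a b} → a ∨ b ≡ true → a ≡ true ⊎ b ≡ true
∨⁻ {true}  _ = inj₁ refl
∨⁻ {false} e = inj₂ e

not⁻ : ∀ {a} → not a ≡ true → a ≡ false
not⁻ {false} _ = refl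

ins-update : ∀ (v : Fin (suc N)) b b′ y → ins v b y [ v ]≔ b′ ≡ ins v b′ y
ins-update zero    b b′ y       = refl
ins-update (suc v) b b′ (x ∷ y) = cong (x ∷_) (ins-update v b b′ y)

size-update : ∀ (z : Vec Bool N) v → lookup z v ≡ false → size (z [ v ]≔ true) ≡ suc (size z)
size-update (false ∷ z) zero    eq = refl
size-update (true  ∷ z) (suc v) eq = cong suc (size-update z v eq)
size-update (false ∷ z) (suc v) eq = size-update z v eq

#-mono-< : ∀ {𝒜 ℬ : 𝔽 N} → (∀ x → 𝒜 x ≡ true → ℬ x ≡ true) →
           ∀ z → 𝒜 z ≡ false → ℬ z ≡ true → # 𝒜 < # ℬ
#-mono-< 𝒜⊆ℬ []          z∉ z∈ rewrite z∉ | z∈ = ≤-refl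
#-mono-< 𝒜⊆ℬ (true  ∷ z) z∉ z∈ =
  +-mono-<-≤ (#-mono-< (𝒜⊆ℬ ∘ (true ∷_)) z z∉ z∈) (#-mono (𝒜⊆ℬ ∘ (false ∷_)))
#-mono-< 𝒜⊆ℬ (false ∷ z) z∉ z∈ =
  +-mono-≤-< (#-mono (𝒜⊆ℬ ∘ (true ∷_))) (#-mono-< (𝒜⊆ℬ ∘ (false ∷_)) z z∉ z∈)

anyᶜ? : ∀ N (𝒜 : 𝔽 N) → Dec (∃[ z ] 𝒜 z ≡ true)
anyᶜ? zero 𝒜 with 𝒜 [] in eq
... | true  = yes ([] , eq)
... | false = no λ { ([] , e) → contradiction (trans (sym eq) e) λ () }
anyᶜ? (suc N) 𝒜 with anyᶜ? N (𝒜 ∘ (true ∷_)) | anyᶜ? N (𝒜 ∘ (false ∷_))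
... | yes (z , e) | _           = yes (true ∷ z , e)
... | no _        | yes (z , e) = yes (false ∷ z , e)
... | no ¬t       | no ¬f       = no λ { (true ∷ z , e) → ¬t (z , e) ; (false ∷ z , e) → ¬f (z , e) }

Full : 𝔽 N → 𝔽 N → Set
Full 𝒜 ℬ = ∀ x v → 𝒜 x ≡ true → lookup x v ≡ true → ℬ (x [ v ]≔ false) ≡ true

-- A full pair on one more element, split into links 𝒜₁, ℬ₁ and deletions 𝒜₀, ℬ₀.
record FullPair (d : ℕ) (𝒜₁ 𝒜₀ ℬ₁ ℬ₀ : 𝔽 N) : Set where
  field
    full₁₀ : ∀ x → 𝒜₁ x ≡ true → ℬ₀ x ≡ true
    full₁₁ : Full 𝒜₁ ℬ₁
    full₀₀ : Full 𝒜₀ ℬ₀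
    size₁  : ∀ x → 𝒜₁ x ≡ true → d ≤ size x
    size₀  : ∀ x → 𝒜₀ x ≡ true → suc d ≤ size x

-- The shift that replaces v by the additional element.
shift₁ shift₀ : Fin N → 𝔽 N → 𝔽 N → 𝔽 N
shift₁ v 𝒜₁ 𝒜₀ z = 𝒜₁ z ∨ (not (lookup z v) ∧ 𝒜₀ (z [ v ]≔ true))
shift₀ v 𝒜₁ 𝒜₀ z = 𝒜₀ z ∧ (not (lookup z v) ∨ 𝒜₁ (z [ v ]≔ false))

shift-# : ∀ (v : Fin N) 𝒜₁ 𝒜₀ → # (shift₁ v 𝒜₁ 𝒜₀) + # (shift₀ v 𝒜₁ 𝒜₀) ≡ # 𝒜₁ + # 𝒜₀
shift-# {suc N} v 𝒜₁ 𝒜₀ = begin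
  # S₁ + # S₀
    ≡⟨ cong₂ _+_ (#-split v S₁) (#-split v S₀) ⟩
  (# (link v S₁) + # (del v S₁)) + (# (link v S₀) + # (del v S₀))
    ≡⟨ regroup (# (link v S₁)) (# (del v S₁)) (# (link v S₀)) (# (del v S₀)) ⟩
  # (link v S₁) + (# (del v S₁) + # (link v S₀)) + # (del v S₀)
    ≡⟨ cong₂ (λ a b → a + (# (del v S₁) + # (link v S₀)) + b) (∑ᶜ-cong N link₁) (∑ᶜ-cong N del₀) ⟩
  # (link v 𝒜₁) + (# (del v S₁) + # (link v S₀)) + # (del v 𝒜₀)
    ≡⟨ cong (λ a → # (link v 𝒜₁) + a + # (del v 𝒜₀))
         (trans (sym (∑ᶜ-+ N _ _)) (trans (∑ᶜ-cong N exchange) (∑ᶜ-+ N _ _))) ⟩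
  # (link v 𝒜₁) + (# (del v 𝒜₁) + # (link v 𝒜₀)) + # (del v 𝒜₀)
    ≡⟨ regroup (# (link v 𝒜₁)) (# (del v 𝒜₁)) (# (link v 𝒜₀)) (# (del v 𝒜₀)) ⟨
  (# (link v 𝒜₁) + # (del v 𝒜₁)) + (# (link v 𝒜₀) + # (del v 𝒜₀))
    ≡⟨ cong₂ _+_ (#-split v 𝒜₁) (#-split v 𝒜₀) ⟨
  # 𝒜₁ + # 𝒜₀ ∎
  where
  open ≡-Reasoning
  S₁ = shift₁ v 𝒜₁ 𝒜₀
  S₀ = shift₀ v 𝒜₁ 𝒜₀
  regroup : ∀ a b e f → (a + b) + (e + f) ≡ a + (b + e) + f
  regroup = solve-∀
  link₁ : ∀ y → ⟦ link v S₁ y ⟧ ≡ ⟦ link v 𝒜₁ y ⟧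
  link₁ y rewrite Vec.insertAt-lookup y v true = cong ⟦_⟧ (Bool.∨-identityʳ _)
  del₀ : ∀ y → ⟦ del v S₀ y ⟧ ≡ ⟦ del v 𝒜₀ y ⟧
  del₀ y rewrite Vec.insertAt-lookup y v false = cong ⟦_⟧ (Bool.∧-identityʳ _)
  exchange : ∀ y → ⟦ del v S₁ y ⟧ + ⟦ link v S₀ y ⟧ ≡ ⟦ del v 𝒜₁ y ⟧ + ⟦ link v 𝒜₀ y ⟧
  exchange y
    rewrite Vec.insertAt-lookup y v true | Vec.insertAt-lookup y v false
          | ins-update v true false y | ins-update v false true y
    with del v 𝒜₁ y | link v 𝒜₀ y
  ... | true  | true  = refl
  ... | true  | false = refl
  ... | false | true  = refl
  ... | false | false = refl

≢-by-lookup : ∀ (z : Vec Bool N) {t v} → lookup z t ≡ true → lookup z v ≡ false → t ≢ v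
≢-by-lookup z t∈ v∉ refl = contradiction (trans (sym t∈) v∉) λ ()

-- The shadow of a compressed family lies in the compressed shadow. The delicate case is a set z of
-- 𝒜₀ that contains v and stays because z - v is in 𝒜₁: for t ≠ v both z - t is in ℬ₀ and z - v - t
-- is in ℬ₁, so z - t stays as well.
shift-full : ∀ {d} (v : Fin N) {𝒜₁ 𝒜₀ ℬ₁ ℬ₀} → FullPair d 𝒜₁ 𝒜₀ ℬ₁ ℬ₀ →
             FullPair d (shift₁ v 𝒜₁ 𝒜₀) (shift₀ v 𝒜₁ 𝒜₀) (shift₁ v ℬ₁ ℬ₀) (shift₀ v ℬ₁ ℬ₀)
shift-full {d = d} v {𝒜₁} {𝒜₀} {ℬ₁} {ℬ₀} P = record
  { full₁₀ = λ z z∈ → full₁₀′ z (∨⁻ {𝒜₁ z} z∈)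
  ; full₁₁ = λ z t z∈ → full₁₁′ z t (∨⁻ {𝒜₁ z} z∈)
  ; full₀₀ = λ z t z∈ → full₀₀′ z t (∧⁻ {𝒜₀ z} z∈)
  ; size₁  = λ z z∈ → size₁′ z (∨⁻ {𝒜₁ z} z∈)
  ; size₀  = λ z z∈ → size₀ z (proj₁ (∧⁻ {𝒜₀ z} z∈))
  }
  where
  open FullPair P
  In₁ : Vec Bool _ → Set
  In₁ z = 𝒜₁ z ≡ true ⊎ not (lookup z v) ∧ 𝒜₀ (z [ v ]≔ true) ≡ true
  update² : ∀ (z : Vec Bool _) → lookup z v ≡ false → (z [ v ]≔ true) [ v ]≔ false ≡ z
  update² z eq = trans (Vec.[]≔-idempotent z v)
                       (subst (λ b → z [ v ]≔ b ≡ z) eq (Vec.[]≔-lookup z v))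
  full₁₀′ : ∀ z → In₁ z → shift₀ v ℬ₁ ℬ₀ z ≡ true
  full₁₀′ z (inj₁ z∈) rewrite full₁₀ z z∈ with lookup z v in eq
  ... | false = refl
  ... | true  = full₁₁ z v z∈ eq
  full₁₀′ z (inj₂ e) with ∧⁻ {not (lookup z v)} e
  ... | v∉ , z∈ rewrite not⁻ v∉
                      | subst (λ w → ℬ₀ w ≡ true) (update² z (not⁻ v∉))
                          (full₀₀ (z [ v ]≔ true) v z∈ (Vec.lookup∘update v z true)) = refl
  full₁₁′ : ∀ z t → In₁ z → lookup z t ≡ true → shift₁ v ℬ₁ ℬ₀ (z [ t ]≔ false) ≡ true
  full₁₁′ z t (inj₁ z∈) t∈ rewrite full₁₁ z t z∈ t∈ = refl
  full₁₁′ z t (inj₂ e) t∈ with ∧⁻ {not (lookup z v)} e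
  ... | v∉ , z∈ with ≢-by-lookup z t∈ (not⁻ v∉)
  ... | t≢v
    rewrite trans (Vec.lookup∘update′ (t≢v ∘ sym) z false) (not⁻ v∉)
          | Vec.[]≔-commutes {x = false} {y = true} z t v t≢v
          | full₀₀ (z [ v ]≔ true) t z∈ (trans (Vec.lookup∘update′ t≢v z true) t∈) = Bool.∨-zeroʳ _
  full₀₀′ : ∀ z t → 𝒜₀ z ≡ true × not (lookup z v) ∨ 𝒜₁ (z [ v ]≔ false) ≡ true →
            lookup z t ≡ true → shift₀ v ℬ₁ ℬ₀ (z [ t ]≔ false) ≡ true
  full₀₀′ z t (z∈ , e) t∈ rewrite full₀₀ z t z∈ t∈ with t Fin.≟ v
  ... | yes refl rewrite Vec.lookup∘update t z false = refl
  ... | no t≢v rewrite Vec.lookup∘update′ (t≢v ∘ sym) z false with ∨⁻ {not (lookup z v)} e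
  ... | inj₁ v∉ rewrite v∉ = refl
  ... | inj₂ z-v∈ rewrite Vec.[]≔-commutes {x = false} {y = false} z t v t≢v
                       | full₁₁ (z [ v ]≔ false) t z-v∈ (trans (Vec.lookup∘update′ t≢v z false) t∈) = Bool.∨-zeroʳ _
  size₁′ : ∀ z → In₁ z → d ≤ size z
  size₁′ z (inj₁ z∈) = size₁ z z∈
  size₁′ z (inj₂ e)  =
    let v∉ , z∈ = ∧⁻ {not (lookup z v)} e
    in  ≤-pred (≤-trans (size₀ _ z∈) (≤-reflexive (size-update z v (not⁻ v∉))))

-- A shift that changes 𝒜₀ moves a set from it to 𝒜₁, so the bound n on its size is a termination
-- measure. Once no shift applies, the link 𝒜₁ contains the shadow of the deletion 𝒜₀, which lets
-- the induction treat the two as a full pair.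
stabilise : ∀ {d} n {𝒜₁ 𝒜₀ ℬ₁ ℬ₀ : 𝔽 N} → FullPair d 𝒜₁ 𝒜₀ ℬ₁ ℬ₀ → # 𝒜₀ ≤ n →
  ∃[ 𝒜₁′ ] ∃[ 𝒜₀′ ] ∃[ ℬ₁′ ] ∃[ ℬ₀′ ] FullPair d 𝒜₁′ 𝒜₀′ ℬ₁′ ℬ₀′ × Full 𝒜₀′ 𝒜₁′ ×
    # 𝒜₁′ + # 𝒜₀′ ≡ # 𝒜₁ + # 𝒜₀ × # ℬ₁′ + # ℬ₀′ ≡ # ℬ₁ + # ℬ₀
stabilise {N} n {𝒜₁} {𝒜₀} {ℬ₁} {ℬ₀} P ≤n
  with Fin.any? (λ v → anyᶜ? N (λ z → 𝒜₀ z ∧ (lookup z v ∧ not (𝒜₁ (z [ v ]≔ false)))))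
... | no stable = 𝒜₁ , 𝒜₀ , ℬ₁ , ℬ₀ , P , full , refl , refl
  where
  full : Full 𝒜₀ 𝒜₁
  full z v z∈ v∈ with 𝒜₁ (z [ v ]≔ false) in eq
  ... | true  = refl
  ... | false = contradiction (v , z , (begin
      𝒜₀ z ∧ (lookup z v ∧ not (𝒜₁ (z [ v ]≔ false)))
        ≡⟨ cong₂ _∧_ z∈ (cong₂ (λ a b → a ∧ not b) v∈ eq) ⟩
      true ∎)) stable
    where open ≡-Reasoning
... | yes (v , z , e) with n
... | zero  = contradiction (<-≤-trans (#-mono-< {𝒜 = λ _ → false} (λ _ ()) z refl (proj₁ (∧⁻ e))) ≤n) λ ()
... | suc n =
  let 𝒜₁′ , 𝒜₀′ , ℬ₁′ , ℬ₀′ , P′ , full , #𝒜 , #ℬ =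
        stabilise n (shift-full v P) (≤-pred (≤-trans decrease ≤n))
  in  𝒜₁′ , 𝒜₀′ , ℬ₁′ , ℬ₀′ , P′ , full ,
      trans #𝒜 (shift-# v 𝒜₁ 𝒜₀) , trans #ℬ (shift-# v ℬ₁ ℬ₀)
  where
  z∉ : shift₀ v 𝒜₁ 𝒜₀ z ≡ false
  z∉ with ∧⁻ {𝒜₀ z} e
  ... | z∈ , e′ with ∧⁻ {lookup z v} e′
  ... | v∈ , ∉ rewrite z∈ | v∈ | not⁻ ∉ = refl
  decrease : # (shift₀ v 𝒜₁ 𝒜₀) < # 𝒜₀
  decrease = #-mono-< (λ x x∈ → proj₁ (∧⁻ x∈)) z z∉ (proj₁ (∧⁻ e))

-- Frankl's argument: if the link 𝒜₁ has at most val (c - 1) members, induction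
-- applies to 𝒜₀ with shadow in 𝒜₁; otherwise ℬ₁ is large and hence ℬ₀ ⊇ 𝒜₁ is small.
kruskal-katona : ∀ N d c (𝒜 ℬ : 𝔽 N) → Full 𝒜 ℬ → (∀ x → 𝒜 x ≡ true → suc d ≤ size x) →
                 # ℬ ≤ val d c → # 𝒜 ≤ val′ d c
kruskal-katona zero d c 𝒜 ℬ full large _ =
  ≤-trans (≤-reflexive (#≡0 𝒜 λ { [] []∈ → contradiction (large [] []∈) λ () })) z≤n
kruskal-katona (suc N) zero c 𝒜 ℬ full large b≤0 = +-mono-≤
  (≤-trans (#-mono (λ x x∈ → full (true ∷ x) zero x∈ refl)) q≤0)
  (kruskal-katona N 0 c _ _ (λ x v → full (false ∷ x) (suc v)) (λ x → large (false ∷ x)) q≤0)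
  where
  q≤0 : # (ℬ ∘ (false ∷_)) ≤ 0
  q≤0 = ≤-trans (m≤n+m _ (# (ℬ ∘ (true ∷_)))) b≤0
kruskal-katona (suc N) (suc d) c 𝒜 ℬ full large b≤
  with stabilise _ {𝒜 ∘ (true ∷_)} {𝒜 ∘ (false ∷_)} {ℬ ∘ (true ∷_)} {ℬ ∘ (false ∷_)} (record
    { full₁₀ = λ x x∈ → full (true ∷ x) zero x∈ refl
    ; full₁₁ = λ x v → full (true ∷ x) (suc v)
    ; full₀₀ = λ x v → full (false ∷ x) (suc v)
    ; size₁  = λ x x∈ → ≤-pred (large (true ∷ x) x∈)
    ; size₀  = λ x → large (false ∷ x)
    }) ≤-refl
... | 𝒜₁ , 𝒜₀ , ℬ₁ , ℬ₀ , P , stable , #𝒜 , #ℬ = subst (_≤ val′ (suc d) c) #𝒜 bound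
  where
  open FullPair P
  open ≤-Reasoning
  c⁻ c′ : ℕ → ℕ
  c⁻ i = c i ∸ 1
  c′ i = c (suc i) ∸ 1
  bound : # 𝒜₁ + # 𝒜₀ ≤ val′ (suc d) c
  bound with # 𝒜₁ ≤? val (suc d) c⁻
  ... | yes m≤ = begin
    # 𝒜₁ + # 𝒜₀                      ≤⟨ +-mono-≤ m≤ (kruskal-katona N (suc d) c⁻ 𝒜₀ 𝒜₁ stable size₀ m≤) ⟩
    val (suc d) c⁻ + val′ (suc d) c⁻ ≤⟨ pred-val (suc d) c ⟩
    val′ (suc d) c                   ∎
  ... | no m≰ with # ℬ₁ ≤? val d c′
  ... | yes p≤ = contradiction (≤-trans (kruskal-katona N d c′ 𝒜₁ ℬ₁ full₁₁ size₁ p≤) (val′-shift d c)) m≰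
  ... | no p≰ = contradiction (≤-trans (#-mono full₁₀) (+-cancelˡ-≤ (# ℬ₁) _ _ (begin
    # ℬ₁ + # ℬ₀                          ≡⟨ #ℬ ⟩
    # ℬ                                  ≤⟨ b≤ ⟩
    val (suc d) c                        ≤⟨ val-shift d c ⟩
    suc (val (suc d) c⁻ + val d c′)      ≡⟨ cong suc (+-comm (val (suc d) c⁻) (val d c′)) ⟩
    suc (val d c′) + val (suc d) c⁻      ≤⟨ +-monoˡ-≤ _ (≰⇒> p≰) ⟩
    # ℬ₁ + val (suc d) c⁻                ∎))) m≰

-- Double counting heavy pairs

∑ᶠ : ∀ N → (Fin N → ℕ) → ℕ
∑ᶠ zero    g = 0
∑ᶠ (suc N) g = g zero + ∑ᶠ N (g ∘ suc)

∑ᶠ-mono : ∀ N {g h : Fin N → ℕ} → (∀ v → g v ≤ h v) → ∑ᶠ N g ≤ ∑ᶠ N h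
∑ᶠ-mono zero    g≤h = z≤n
∑ᶠ-mono (suc N) g≤h = +-mono-≤ (g≤h zero) (∑ᶠ-mono N (g≤h ∘ suc))

∑ᶠ-cong : ∀ N {g h : Fin N → ℕ} → (∀ v → g v ≡ h v) → ∑ᶠ N g ≡ ∑ᶠ N h
∑ᶠ-cong zero    g≡h = refl
∑ᶠ-cong (suc N) g≡h = cong₂ _+_ (g≡h zero) (∑ᶠ-cong N (g≡h ∘ suc))

∑ᶠ-+ : ∀ N (g h : Fin N → ℕ) → ∑ᶠ N (λ v → g v + h v) ≡ ∑ᶠ N g + ∑ᶠ N h
∑ᶠ-+ zero    g h = refl
∑ᶠ-+ (suc N) g h = trans (cong (g zero + h zero +_) (∑ᶠ-+ N (g ∘ suc) (h ∘ suc)))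
  (+-interchange (g zero) (h zero) (∑ᶠ N (g ∘ suc)) (∑ᶠ N (h ∘ suc)))

∑ᶠ-*ʳ : ∀ N k (g : Fin N → ℕ) → ∑ᶠ N (λ v → g v * k) ≡ ∑ᶠ N g * k
∑ᶠ-*ʳ zero    k g = refl
∑ᶠ-*ʳ (suc N) k g = trans (cong (g zero * k +_) (∑ᶠ-*ʳ N k (g ∘ suc)))
                          (sym (*-distribʳ-+ k (g zero) (∑ᶠ N (g ∘ suc))))

∑ᶠ-∑ᶜ : ∀ M (h : Fin M → Vec Bool N → ℕ) →
        ∑ᶠ M (λ v → ∑ᶜ N (h v)) ≡ ∑ᶜ N (λ x → ∑ᶠ M (λ v → h v x))
∑ᶠ-∑ᶜ {N} zero    h = sym (∑ᶜ-zero N λ _ → refl)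
∑ᶠ-∑ᶜ {N} (suc M) h = trans (cong (∑ᶜ N (h zero) +_) (∑ᶠ-∑ᶜ M (h ∘ suc))) (sym (∑ᶜ-+ N _ _))

∑ᶠ-link : ∀ N (h : Fin (suc N) → Vec Bool (suc N) → ℕ) →
  ∑ᶠ (suc N) (λ v → ∑ᶜ N (h v ∘ ins v true)) ≡
  ∑ᶜ (suc N) (λ x → ∑ᶠ (suc N) (λ v → ⟦ lookup x v ⟧ * h v x))
∑ᶠ-link N h = trans (∑ᶠ-cong (suc N) λ v → begin
  ∑ᶜ N (h v ∘ ins v true)
    ≡⟨ +-identityʳ _ ⟨
  ∑ᶜ N (h v ∘ ins v true) + 0
    ≡⟨ cong₂ _+_ (∑ᶜ-cong N (λ y → sym (inside v y))) (sym (∑ᶜ-zero N (outside v))) ⟩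
  ∑ᶜ N (weighted v ∘ ins v true) + ∑ᶜ N (weighted v ∘ ins v false)
    ≡⟨ ∑ᶜ-split v (weighted v) ⟨
  ∑ᶜ (suc N) (weighted v) ∎) (∑ᶠ-∑ᶜ (suc N) weighted)
  where
  open ≡-Reasoning
  weighted : Fin (suc N) → Vec Bool (suc N) → ℕ
  weighted v x = ⟦ lookup x v ⟧ * h v x
  inside : ∀ v y → weighted v (ins v true y) ≡ h v (ins v true y)
  inside v y rewrite Vec.insertAt-lookup y v true = *-identityˡ _
  outside : ∀ v y → weighted v (ins v false y) ≡ 0
  outside v y rewrite Vec.insertAt-lookup y v false = refl

size-sum : ∀ (x : Vec Bool N) → size x ≡ ∑ᶠ N (λ v → ⟦ lookup x v ⟧)
size-sum []          = refl
size-sum (true  ∷ x) = cong suc (size-sum x)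
size-sum (false ∷ x) = size-sum x

τ-sum : ∀ (ℬ : 𝔽 N) x → τ ℬ x ≡ ∑ᶠ N (λ v → ⟦ lookup x v ∧ ℬ (x [ v ]≔ false) ⟧)
τ-sum ℬ []          = refl
τ-sum ℬ (true  ∷ x) = cong (⟦ ℬ (false ∷ x) ⟧ +_) (τ-sum (ℬ ∘ (true ∷_)) x)
τ-sum ℬ (false ∷ x) = τ-sum (ℬ ∘ (false ∷_)) x

τ≤size : ∀ (ℬ : 𝔽 N) x → τ ℬ x ≤ size x
τ≤size ℬ []          = z≤n
τ≤size ℬ (true  ∷ x) = +-mono-≤ (⟦⟧≤1 (ℬ (false ∷ x))) (τ≤size (ℬ ∘ (true ∷_)) x)
τ≤size ℬ (false ∷ x) = τ≤size (ℬ ∘ (false ∷_)) x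

size≤τ⇒full : ∀ (ℬ : 𝔽 N) x v → size x ≤ τ ℬ x → lookup x v ≡ true → ℬ (x [ v ]≔ false) ≡ true
size≤τ⇒full ℬ (true  ∷ x) zero    ≤τ v∈ with ℬ (false ∷ x)
... | true  = refl
... | false = contradiction (≤-trans ≤τ (τ≤size (ℬ ∘ (true ∷_)) x)) (<-irrefl refl)
size≤τ⇒full ℬ (true  ∷ x) (suc v) ≤τ v∈ = size≤τ⇒full (ℬ ∘ (true ∷_)) x v
  (≤-pred (≤-trans ≤τ (+-monoˡ-≤ _ (⟦⟧≤1 (ℬ (false ∷ x)))))) v∈
size≤τ⇒full ℬ (false ∷ x) (suc v) ≤τ v∈ = size≤τ⇒full (ℬ ∘ (false ∷_)) x v ≤τ v∈

record Config (r k : ℕ) (𝒜 ℬ : 𝔽 N) : Set where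
  field
    size-𝒜  : ∀ x → 𝒜 x ≡ true → size x ≡ r
    size-ℬ  : ∀ x → ℬ x ≡ true → suc (size x) ≡ r
    covered : Covered k 𝒜 ℬ

module _ {r k N : ℕ} (v : Fin (suc N)) {𝒜 ℬ : 𝔽 (suc N)} (cfg : Config r k 𝒜 ℬ) where
  open Config cfg

  config-del : Config r k (del v 𝒜) (del v ℬ)
  config-del = record
    { size-𝒜  = λ y y∈ → trans (sym (size-ins-false v y)) (size-𝒜 ( ins v false y) y∈)
    ; size-ℬ  = λ y y∈ → trans (cong suc (sym (size-ins-false v y))) (size-ℬ (ins v false y) y∈)
    ; covered = covered-del v {𝒜} {ℬ} covered
    }

  config-link∖del : Config (pred r) k (link v 𝒜 ∖ del v ℬ) (link v ℬ)
  config-link∖del = record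
    { size-𝒜  = λ y y∈ → cong pred (trans (sym (size-ins-true v y)) (size-𝒜 (ins v true y) (proj₁ (∧⁻ {link v 𝒜 y} y∈))))
    ; size-ℬ  = λ y y∈ → trans (sym (size-ins-true v y)) (cong pred (size-ℬ (ins v true y) y∈))
    ; covered = covered-link∖del v {𝒜} {ℬ} covered
    }

module _ {r d N : ℕ} {𝒜 ℬ : 𝔽 (suc N)} (cfg : Config r (suc d) 𝒜 ℬ) where
  open Config cfg
  open ≤-Reasoning

  private
    k = suc d

    -- For v in x: x - v is still covered k times in the link of v, where the set x - v itself no
    -- longer counts.
    heavy : Fin (suc N) → 𝔽 (suc N)
    heavy v x = 𝒜 x ∧ (k + ⟦ ℬ (x [ v ]≔ false) ⟧ ≤ᵇ τ ℬ x)

    heavies : Vec Bool (suc N) → ℕ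
    heavies x = ∑ᶠ (suc N) (λ v → ⟦ lookup x v ⟧ * ⟦ k + ⟦ ℬ (x [ v ]≔ false) ⟧ ≤ᵇ τ ℬ x ⟧)

    covered-heavy : ∀ v → Covered k (link v (heavy v)) (link v ℬ)
    covered-heavy v y y∈ = +-cancelʳ-≤ ⟦ del v ℬ y ⟧ k (τ (link v ℬ) y) (begin
      k + ⟦ del v ℬ y ⟧                            ≡⟨ cong (λ z → k + ⟦ ℬ z ⟧) (ins-update v true false y) ⟨
      k + ⟦ ℬ (ins v true y [ v ]≔ false) ⟧        ≤⟨ ≤ᵇ⇒≤ _ _ (subst T (sym (proj₂ (∧⁻ {𝒜 (ins v true y)} y∈))) tt) ⟩
      τ ℬ (ins v true y)                           ≡⟨ τ-ins-true v ℬ y ⟩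
      ⟦ del v ℬ y ⟧ + τ (link v ℬ) y               ≡⟨ +-comm ⟦ del v ℬ y ⟧ _ ⟩
      τ (link v ℬ) y + ⟦ del v ℬ y ⟧               ∎)

    -- Among the v ∈ x at most k are not heavy: if x covers more than k sets
    -- all are heavy, and otherwise those with x - v ∉ ℬ are.
    size-≤ : ∀ x → 𝒜 x ≡ true →
             size x ≤ k + heavies x
    size-≤ x x∈ with τ ℬ x ≤? k
    ... | no k<τ = ≤-trans (≤-reflexive (size-sum x)) (≤-trans (∑ᶠ-mono (suc N) all-heavy) (m≤n+m _ k))
      where
      all-heavy : ∀ v → ⟦ lookup x v ⟧ ≤ ⟦ lookup x v ⟧ * ⟦ k + ⟦ ℬ (x [ v ]≔ false) ⟧ ≤ᵇ τ ℬ x ⟧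
      all-heavy v = begin
        ⟦ lookup x v ⟧       ≡⟨ *-identityʳ _ ⟨
        ⟦ lookup x v ⟧ * 1   ≡⟨ cong (λ b → ⟦ lookup x v ⟧ * ⟦ b ⟧) (dec-true (_ ≤? _) (begin
          k + ⟦ ℬ (x [ v ]≔ false) ⟧     ≤⟨ +-monoʳ-≤ k (⟦⟧≤1 (ℬ (x [ v ]≔ false))) ⟩
          k + 1                          ≡⟨ +-comm k 1 ⟩
          suc k                          ≤⟨ ≰⇒> k<τ ⟩
          τ ℬ x                          ∎)) ⟨
        ⟦ lookup x v ⟧ * ⟦ k + ⟦ ℬ (x [ v ]≔ false) ⟧ ≤ᵇ τ ℬ x ⟧   ∎
    ... | yes τ≤k = begin
      size x                                                   ≡⟨ size-sum x ⟩
      ∑ᶠ (suc N) (λ v → ⟦ lookup x v ⟧)                        ≤⟨ ∑ᶠ-mono (suc N) light ⟩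
      ∑ᶠ (suc N) (λ v → below v + above v)                     ≡⟨ ∑ᶠ-+ (suc N) below above ⟩
      ∑ᶠ (suc N) below + ∑ᶠ (suc N) above                      ≡⟨ cong (_+ ∑ᶠ (suc N) above) (τ-sum ℬ x) ⟨
      τ ℬ x + ∑ᶠ (suc N) above                                 ≤⟨ +-monoˡ-≤ _ τ≤k ⟩
      k + ∑ᶠ (suc N) above                                     ∎
      where
      below above : Fin (suc N) → ℕ
      below v = ⟦ lookup x v ∧ ℬ (x [ v ]≔ false) ⟧
      above v = ⟦ lookup x v ⟧ * ⟦ k + ⟦ ℬ (x [ v ]≔ false) ⟧ ≤ᵇ τ ℬ x ⟧
      light : ∀ v → ⟦ lookup x v ⟧ ≤ below v + above v
      light v with lookup x v | ℬ (x [ v ]≔ false)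
      ... | false | _     = z≤n
      ... | true  | true  = s≤s z≤n
      ... | true  | false rewrite dec-true (k + 0 ≤? τ ℬ x) (≤-trans (≤-reflexive (+-identityʳ k)) (covered x x∈)) = ≤-refl

    double-count-𝒜 : r * # 𝒜 ≤ k * # 𝒜 + ∑ᶠ (suc N) (λ v → # (link v (heavy v)))
    double-count-𝒜 = begin
      r * # 𝒜
        ≡⟨ ∑ᶜ-* (suc N) r (λ x → ⟦ 𝒜 x ⟧) ⟨
      ∑ᶜ (suc N) (λ x → r * ⟦ 𝒜 x ⟧)
        ≤⟨ ∑ᶜ-mono (suc N) bound ⟩
      ∑ᶜ (suc N) (λ x → k * ⟦ 𝒜 x ⟧ + weight x)
        ≡⟨ ∑ᶜ-+ (suc N) (λ x → k * ⟦ 𝒜 x ⟧) weight ⟩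
      ∑ᶜ (suc N) (λ x → k * ⟦ 𝒜 x ⟧) + ∑ᶜ (suc N) weight
        ≡⟨ cong₂ _+_ (∑ᶜ-* (suc N) k (λ x → ⟦ 𝒜 x ⟧)) (sym (∑ᶠ-link N (λ v x → ⟦ heavy v x ⟧))) ⟩
      k * # 𝒜 + ∑ᶠ (suc N) (λ v → # (link v (heavy v))) ∎
      where
      weight : Vec Bool (suc N) → ℕ
      weight x = ∑ᶠ (suc N) (λ v → ⟦ lookup x v ⟧ * ⟦ heavy v x ⟧)
      bound : ∀ x → r * ⟦ 𝒜 x ⟧ ≤ k * ⟦ 𝒜 x ⟧ + weight x
      bound x with 𝒜 x in eq
      ... | false = ≤-trans (≤-reflexive (*-zeroʳ r)) z≤n
      ... | true  = begin
        r * 1         ≡⟨ *-identityʳ r ⟩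
        r             ≡⟨ size-𝒜 x eq ⟨
        size x        ≤⟨ size-≤ x eq ⟩
        k + heavies x                                ≡⟨ cong (_+ heavies x) (*-identityʳ k) ⟨
        k * 1 + heavies x                            ∎

    double-count-ℬ : ∑ᶠ (suc N) (λ v → # (link v ℬ)) ≡ pred r * # ℬ
    double-count-ℬ = begin-equality
      ∑ᶠ (suc N) (λ v → # (link v ℬ))                                   ≡⟨ ∑ᶠ-link N (λ _ x → ⟦ ℬ x ⟧) ⟩
      ∑ᶜ (suc N) (λ x → ∑ᶠ (suc N) (λ v → ⟦ lookup x v ⟧ * ⟦ ℬ x ⟧))    ≡⟨ ∑ᶜ-cong (suc N) weight ⟩
      ∑ᶜ (suc N) (λ x → pred r * ⟦ ℬ x ⟧)                               ≡⟨ ∑ᶜ-* (suc N) (pred r) (λ x → ⟦ ℬ x ⟧) ⟩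
      pred r * # ℬ                                                      ∎
      where
      weight : ∀ x → ∑ᶠ (suc N) (λ v → ⟦ lookup x v ⟧ * ⟦ ℬ x ⟧) ≡ pred r * ⟦ ℬ x ⟧
      weight x rewrite ∑ᶠ-*ʳ (suc N) ⟦ ℬ x ⟧ (λ v → ⟦ lookup x v ⟧) | sym (size-sum x) with ℬ x in eq
      ... | false = trans (*-zeroʳ (size x)) (sym (*-zeroʳ (pred r)))
      ... | true  = cong (_* 1) (cong pred (size-ℬ x eq))

  -- Either r ≤ k, so that every member of 𝒜 has its full shadow in ℬ, or a
  -- positive proportion of the pairs v ∈ x ∈ 𝒜 are heavy and hence counted by
  -- the crude bound for the links.
  small-links : ∀ y → (∀ v → # (link v ℬ) < (suc y + d) C d) →
                (∀ c → # ℬ ≤ val d c → # 𝒜 ≤ val′ d c) ⊎ # 𝒜 ≤ suc d * (# ℬ * y)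
  small-links y small with r ≤? k
  ... | yes r≤k = inj₁ λ c → kruskal-katona (suc N) d c 𝒜 ℬ
    (λ x v x∈ → size≤τ⇒full ℬ x v (≤-trans (≤-trans (≤-reflexive (size-𝒜 x x∈)) r≤k) (covered x x∈)))
    (λ x x∈ → ≤-trans (covered x x∈) (τ≤size ℬ x))
  ... | no r≰k = inj₂ (*-cancelˡ-≤ (suc e) (+-cancelˡ-≤ (k * # 𝒜) _ _ (begin
    k * # 𝒜 + suc e * # 𝒜                                    ≡⟨ *-distribʳ-+ (# 𝒜) k (suc e) ⟨
    (k + suc e) * # 𝒜                                        ≡⟨ cong (_* # 𝒜) r≡ ⟨
    r * # 𝒜                                                  ≤⟨ double-count-𝒜 ⟩
    k * # 𝒜 + ∑ᶠ (suc N) (λ v → # (link v (heavy v)))        ≤⟨ +-monoʳ-≤ (k * # 𝒜) (begin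
      ∑ᶠ (suc N) (λ v → # (link v (heavy v)))    ≤⟨ ∑ᶠ-mono (suc N) (λ v → crude-bound N d y _ _ (covered-heavy v) (small v)) ⟩
      ∑ᶠ (suc N) (λ v → # (link v ℬ) * y)        ≡⟨ ∑ᶠ-*ʳ (suc N) y (λ v → # (link v ℬ)) ⟩
      ∑ᶠ (suc N) (λ v → # (link v ℬ)) * y        ≡⟨ cong (_* y) double-count-ℬ ⟩
      pred r * # ℬ * y                           ≡⟨ *-assoc (pred r) (# ℬ) y ⟩
      pred r * (# ℬ * y)                         ≤⟨ *-monoˡ-≤ (# ℬ * y) pred-r≤ ⟩
      suc e * k * (# ℬ * y)                      ≡⟨ *-assoc (suc e) k (# ℬ * y) ⟩
      suc e * (k * (# ℬ * y))                    ∎) ⟩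
    k * # 𝒜 + suc e * (k * (# ℬ * y))                        ∎)))
    where
    e = r ∸ suc k
    r≡ : r ≡ k + suc e
    r≡ = trans (sym (m+[n∸m]≡n (≰⇒> r≰k))) (sym (+-suc k e))
    -- Since r - k = e + 1, this is (r - 1) / (r - k) ≤ k, which frees the bound from r.
    pred-r≤ : pred r ≤ suc e * k
    pred-r≤ = begin
      pred r            ≡⟨ cong pred r≡ ⟩
      d + suc e         ≡⟨ +-suc d e ⟩
      k + e             ≤⟨ +-monoʳ-≤ k (m≤m*n e k) ⟩
      k + e * k         ∎

-- The upper bound

-- Members of 𝒜 containing v either have v among their removable elements, and
-- are then counted by ℬ, or remain covered k times in the link.
#-decompose : ∀ (v : Fin (suc N)) 𝒜 ℬ →
              # 𝒜 ≤ # (link v 𝒜 ∖ del v ℬ) + # (del v ℬ) + # (del v 𝒜)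
#-decompose v 𝒜 ℬ = ≤-trans (≤-reflexive (#-split v 𝒜)) (+-monoˡ-≤ _ (#-∖ (link v 𝒜) (del v ℬ)))

-- Applied with `c ∸ m` equal to `θ`: if one part exceeds `θ`, the rest fits into the smaller
-- binomial coefficient.
+-≤∸ : ∀ {a b c m} → a + b ≤ c → c ∸ m < a → b ≤ m
+-≤∸ {a} {b} {c} {m} a+b≤c c∸m<a = +-cancelˡ-≤ a b m (begin
  a + b              ≤⟨ a+b≤c ⟩
  c                  ≤⟨ m≤n+m∸n c m ⟩
  m + (c ∸ m)        ≤⟨ +-monoʳ-≤ m (<⇒≤ c∸m<a) ⟩
  m + a              ≡⟨ +-comm m a ⟩
  a + m              ∎)
  where open ≤-Reasoning

-- Asymptotically sharp: the leading term of C(n, d + 1) / C(n, d) is n / (d + 1).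
weak-bound : ∀ e → let d = suc e in ∃[ E ] (∀ N {r} n (𝒜 ℬ : 𝔽 N) → Config r (suc d) 𝒜 ℬ →
             # ℬ ≤ n C d → suc d * # 𝒜 ≤ # ℬ * (n + E))
-- With k = d + 1, the multiplier k comes from the bound of `C-∸-≤` on `θ`, and the divisor k * k
-- absorbs the factor in k * (k * (b * y)).
weak-bound e with C-dominates (suc e) (2+ e) (2+ e * 2+ e)
... | μ , dom = d * n₀ , bound
  where
  open ≤-Reasoning
  d k n₀ E : ℕ
  d = suc e
  k = suc d
  n₀ = μ + k
  -- Below n₀ the crude bound is used, which exceeds the target b * n by d * (b * n).
  E = d * n₀

  bound : ∀ N {r} n (𝒜 ℬ : 𝔽 N) → Config r k 𝒜 ℬ → # ℬ ≤ n C d → k * # 𝒜 ≤ # ℬ * (n + E)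
  bound zero n 𝒜 ℬ cfg _ rewrite #≡0-[] {𝒜 = 𝒜} {ℬ} (Config.covered cfg) | *-zeroʳ e = z≤n
  bound (suc N) zero 𝒜 ℬ cfg b≤ = begin
    k * # 𝒜          ≤⟨ *-monoʳ-≤ k (crude-bound (suc N) d 0 𝒜 ℬ (Config.covered cfg) (≤-<-trans b≤ (C-<-shift 0 e))) ⟩
    k * (# ℬ * 0)    ≡⟨ cong (k *_) (*-zeroʳ (# ℬ)) ⟩
    k * 0            ≡⟨ *-zeroʳ k ⟩
    0                ≤⟨ z≤n ⟩
    # ℬ * (0 + E)    ∎
  bound (suc N) (suc n) 𝒜 ℬ cfg b≤ with n₀ ≤? suc n
  ... | no n₀≰ = begin
    k * # 𝒜                       ≤⟨ *-monoʳ-≤ k (crude-bound (suc N) d (suc n) 𝒜 ℬ (Config.covered cfg) (≤-<-trans b≤ (C-<-shift (suc n) e))) ⟩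
    k * (# ℬ * suc n)             ≡⟨ regroup d (# ℬ) (suc n) ⟩
    # ℬ * (suc n + d * suc n)     ≤⟨ *-monoʳ-≤ (# ℬ) (+-monoʳ-≤ (suc n) (*-monoʳ-≤ d (≰⇒≥ n₀≰))) ⟩
    # ℬ * (suc n + E)             ∎
    where
    regroup : ∀ d b n → suc d * (b * n) ≡ b * (n + d * n)
    regroup = solve-∀
  ... | yes n₀≤ with dom (suc n) (≤-trans (m≤m+n μ k) n₀≤)
  ... | y , Ly≤n , y-large = split (Fin.any? (λ v → θ <? # (link v ℬ)))
    where
    d≤n : d ≤ n
    d≤n = ≤-pred (≤-trans (m≤n+m k μ) n₀≤)
    -- The current value is `suc n`, so m lies k below it. Treating the deletion with m saves k * q,
    -- which pays for the q sets A with A - v in ℬ.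
    m = n ∸ d
    θ = suc n C d ∸ m C d
    split : Dec (∃[ v ] θ < # (link v ℬ)) → k * # 𝒜 ≤ # ℬ * (suc n + E)
    split (yes (v , θ<p)) = begin
      k * # 𝒜
        ≤⟨ *-monoʳ-≤ k (#-decompose v 𝒜 ℬ) ⟩
      k * (# (link v 𝒜 ∖ del v ℬ) + q + # (del v 𝒜))
        ≡⟨ distribute k (# (link v 𝒜 ∖ del v ℬ)) q (# (del v 𝒜)) ⟩
      k * # (link v 𝒜 ∖ del v ℬ) + k * q + k * # (del v 𝒜)
        ≤⟨ +-mono-≤ (+-monoˡ-≤ (k * q) (bound N (suc n) _ _ (config-link∖del v cfg) (≤-trans (m≤m+n p q) p+q≤)))
                    (bound N m _ _ (config-del v cfg) (+-≤∸ p+q≤ θ<p)) ⟩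
      p * (suc n + E) + k * q + q * (m + E)
        ≡⟨ regroup p q (suc n + E) d m E ⟩
      p * (suc n + E) + q * (suc (m + d) + E)
        ≡⟨ cong (λ z → p * (suc n + E) + q * (suc z + E)) (m∸n+n≡m d≤n) ⟩
      p * (suc n + E) + q * (suc n + E)
        ≡⟨ *-distribʳ-+ (suc n + E) p q ⟨
      (p + q) * (suc n + E)
        ≡⟨ cong (_* (suc n + E)) (#-split v ℬ) ⟨
      # ℬ * (suc n + E) ∎
      where
      p = # (link v ℬ)
      q = # (del v ℬ)
      p+q≤ : p + q ≤ suc n C d
      p+q≤ = ≤-trans (≤-reflexive (sym (#-split v ℬ))) b≤
      distribute : ∀ k a b c → k * (a + b + c) ≡ k * a + k * b + k * c
      distribute = solve-∀
      regroup : ∀ p q s k m E → p * s + suc k * q + q * (m + E) ≡ p * s + q * (suc (m + k) + E)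
      regroup = solve-∀
    split (no small) with small-links cfg y (λ v → begin-strict
      # (link v ℬ)           ≤⟨ ≮⇒≥ (λ θ<p → small (v , θ<p)) ⟩
      θ                      ≤⟨ C-∸-≤ n d e d≤n ⟩
      k * (n C e)            ≤⟨ *-monoʳ-≤ k (C-suc-≤ n e) ⟩
      k * (suc n C e)        ≤⟨ y-large e ≤-refl ⟩
      y C d                  <⟨ C-<-shift y e ⟩
      (suc y + d) C d        ∎)
    ... | inj₂ few = begin
      k * # 𝒜                  ≤⟨ *-monoʳ-≤ k few ⟩
      k * (k * (# ℬ * y))      ≡⟨ regroup k (# ℬ) y ⟩
      # ℬ * (k * k * y)        ≤⟨ *-monoʳ-≤ (# ℬ) (≤-trans Ly≤n (m≤m+n (suc n) E)) ⟩
      # ℬ * (suc n + E)        ∎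
      where
      regroup : ∀ k b y → k * (k * (b * y)) ≡ b * (k * k * y)
      regroup = solve-∀
    ... | inj₁ kk with average-cascade e (suc n) (# ℬ) b≤
    ... | c , b≤val , _ , avg = begin
      k * # 𝒜                      ≤⟨ *-monoʳ-≤ k (kk c b≤val) ⟩
      k * val′ d c                 ≤⟨ m≤m+n _ (d * # ℬ) ⟩
      k * val′ d c + d * # ℬ       ≤⟨ avg ⟩
      # ℬ * suc n                  ≤⟨ *-monoʳ-≤ (# ℬ) (m≤m+n (suc n) E) ⟩
      # ℬ * (suc n + E)            ∎

-- The form of `weak` bounds |𝒜| + b, so that applied to a deletion it includes the term q. K is
-- chosen so that (n - K) + E = n - 2d, the largest ratio that `C-suc-*` admits. In `scale` the 4
-- serves `Cut` and `suc K` serves `θ`; of the bounds on L, 8 serves `Cut` and the other the case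
-- where `small-links` leaves few sets.
module Accumulation (e E K L : ℕ)
  (weak : ∀ {N r} n (𝒜 ℬ : 𝔽 N) → Config r (2+ e) 𝒜 ℬ → # ℬ ≤ n C suc e →
          2+ e * # 𝒜 + 2+ e * # ℬ ≤ # ℬ * (n + E))
  (K≡ : E + 2 * suc e ≡ K) (8≤L : 8 ≤ L) (2k²<L : 2 * (2+ e * 2+ e + 1) ≤ L)
  (c : ℕ → ℕ)
  (c-mono : ∀ i j → 1 ≤ i → i < j → j ≤ suc e → c i < c j)
  (large : ∀ i → 1 ≤ i → i ≤ suc e → 2 * (suc e + 4 * E) + 2 ≤ c i)
  (2K≤n : 2 * K ≤ c (suc e))
  (scale : ∀ i → 1 ≤ i → i ≤ suc e →
           ∃[ y ] L * y ≤ c i × (∀ j → j < suc e → (4 + suc K) * (c i C j) ≤ y C suc e))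
  where

  open ≤-Reasoning

  private
    d k n : ℕ
    d = suc e
    k = suc d
    n = c d

    K≤n : K ≤ n
    K≤n = ≤-trans (m≤m+n K _) 2K≤n

    y : ℕ
    y = proj₁ (scale d (s≤s z≤n) ≤-refl)

    Ly≤n : L * y ≤ n
    Ly≤n = proj₁ (proj₂ (scale d (s≤s z≤n) ≤-refl))

    m θ : ℕ
    m = n ∸ K
    θ = suc n C d ∸ m C d

    θ≤ : θ ≤ y C d
    θ≤ = begin
      θ                          ≤⟨ C-∸-≤ n K e K≤n ⟩
      suc K * (n C e)            ≤⟨ *-monoˡ-≤ (n C e) (m≤n+m (suc K) 4) ⟩
      (4 + suc K) * (n C e)      ≤⟨ proj₂ (proj₂ (scale d (s≤s z≤n) ≤-refl)) e ≤-refl ⟩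
      y C d                      ∎

    val≤ : val d c ≤ suc n C d
    val≤ = val<C e c c-mono

    -- The top term C(n, d + 1) alone suffices whenever the average contribution is at most (n - 2d)
    -- / (d + 1).
    finish : ∀ {a} t → t + 2 * d ≤ n → k * a ≤ (suc n C d) * t → a ≤ val′ d c
    finish {a} t t≤ ka≤ = ≤-trans (*-cancelˡ-≤ k (≤-trans ka≤ (C-suc-* n e t t≤))) (m≤n+m _ (val′ e c))

  -- Here S counts the members of ℬ that have been removed, and `lost` the
  -- members of 𝒜 that have been lost with them.
  accumulated : ∀ N {r} S lost (𝒜 ℬ : 𝔽 N) → Config r k 𝒜 ℬ → # ℬ + S ≤ val d c → S ≤ θ →
                (∀ y → S ≤ y C d → k * lost ≤ S * (y + E)) → # 𝒜 + lost ≤ val′ d c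
  accumulated N {r} S lost 𝒜 ℬ cfg b+S≤ S≤θ lost-≤ = by-size N 𝒜 ℬ cfg b+S≤
    where
    cut-d : ∃[ c̃ ] val d c ≤ val d c̃ + S × val′ d c̃ + lost ≤ val′ d c
    cut-d = Cut.cut d E S lost c c-mono large lost-≤
      (λ i 1≤i i<d → let y , Ly≤ , dom = scale i 1≤i (<⇒≤ i<d) in
        y , ≤-trans (*-monoˡ-≤ y 8≤L) Ly≤ , ≤-trans (*-monoˡ-≤ (c i C i) (m≤m+n 4 (suc K))) (dom i i<d))
      (y , ≤-trans (*-monoˡ-≤ y 8≤L) Ly≤n , ≤-trans S≤θ θ≤)
      d ≤-refl (≤-trans (m≤n+m S _) b+S≤)

    by-size : ∀ N (𝒜 ℬ : 𝔽 N) → Config r k 𝒜 ℬ → # ℬ + S ≤ val d c → # 𝒜 + lost ≤ val′ d c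
    by-size zero 𝒜 ℬ cfg b+S≤ rewrite #≡0-[] {𝒜 = 𝒜} {ℬ} (Config.covered cfg) =
      -- No sets are left, but `lost` itself still has to fit under the bound.
      let c̃ , _ , gain = cut-d in ≤-trans (m≤n+m lost _) gain
    by-size (suc N) 𝒜 ℬ cfg b+S≤ with Fin.any? (λ v → θ <? # (link v ℬ))
    ... | no small with small-links cfg y (λ v → ≤-<-trans
            (≤-trans (≮⇒≥ (λ θ<p → small (v , θ<p))) θ≤) (C-<-shift y e))
    ... | inj₁ kk =
      let c̃ , size , gain = cut-d
      in  ≤-trans (+-monoˡ-≤ lost (kk c̃ (+-cancelʳ-≤ S _ _ (≤-trans b+S≤ size)))) gain
    ... | inj₂ few = finish t t+2d≤n (begin
      k * (# 𝒜 + lost)                          ≡⟨ *-distribˡ-+ k (# 𝒜) lost ⟩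
      k * # 𝒜 + k * lost                        ≤⟨ +-mono-≤ (*-monoʳ-≤ k few) (lost-≤ y (≤-trans S≤θ θ≤)) ⟩
      k * (k * (# ℬ * y)) + S * (y + E)         ≤⟨ m≤m+n _ (# ℬ * (y + E) + S * (k * k * y)) ⟩
      k * (k * (# ℬ * y)) + S * (y + E) + (# ℬ * (y + E) + S * (k * k * y))
                                                ≡⟨ regroup k (# ℬ) y S E ⟩
      (# ℬ + S) * t                             ≤⟨ *-monoˡ-≤ t (≤-trans b+S≤ val≤) ⟩
      (suc n C d) * t                             ∎)
      where
      -- One ratio that serves both summands: k * k * y for the sets of 𝒜 and y + E for `lost`.
      t = k * k * y + (y + E)
      regroup : ∀ k b y S E → k * (k * (b * y)) + S * (y + E) + (b * (y + E) + S * (k * k * y)) ≡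
                (b + S) * (k * k * y + (y + E))
      regroup = solve-∀
      double : ∀ k y E d → 2 * (k * k * y + (y + E) + 2 * d) ≡ 2 * (k * k + 1) * y + 2 * (E + 2 * d)
      double = solve-∀
      n+n : ∀ n → n + n ≡ 2 * n
      n+n = solve-∀
      t+2d≤n : t + 2 * d ≤ n
      t+2d≤n = *-cancelˡ-≤ 2 (begin
        2 * (t + 2 * d)                       ≡⟨ double k y E d ⟩
        2 * (k * k + 1) * y + 2 * (E + 2 * d) ≤⟨ +-mono-≤ (≤-trans (*-monoˡ-≤ y 2k²<L) Ly≤n) (≤-trans (≤-reflexive (cong (2 *_) K≡)) 2K≤n) ⟩
        n + n                                 ≡⟨ n+n n ⟩
        2 * n                                 ∎)
    by-size (suc N) 𝒜 ℬ cfg b+S≤ | yes (v , θ<p) with S + # (del v ℬ) ≤? θ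
    ... | yes S+q≤θ = begin
      # 𝒜 + lost
        ≤⟨ +-monoˡ-≤ lost (#-decompose v 𝒜 ℬ) ⟩
      # (link v 𝒜 ∖ del v ℬ) + q + # (del v 𝒜) + lost
        ≡⟨ regroup (# (link v 𝒜 ∖ del v ℬ)) q (# (del v 𝒜)) lost ⟩
      # (link v 𝒜 ∖ del v ℬ) + (lost + (# (del v 𝒜) + q))
        ≤⟨ accumulated N (S + q) (lost + (# (del v 𝒜) + q)) _ _ (config-link∖del v cfg)
             (≤-trans (≤-reflexive p+S+q≡) b+S≤) S+q≤θ more-lost ⟩
      val′ d c ∎
      where
      p = # (link v ℬ)
      q = # (del v ℬ)
      regroup : ∀ a q b l → a + q + b + l ≡ a + (l + (b + q))
      regroup = solve-∀
      p+S+q≡ : p + (S + q) ≡ # ℬ + S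
      p+S+q≡ = trans (swap p S q) (cong (_+ S) (sym (#-split v ℬ)))
        where
        swap : ∀ p S q → p + (S + q) ≡ (p + q) + S
        swap = solve-∀
      -- S + q ≤ C(y, d) bounds S and q separately, so the same y serves both and the error E does
      -- not grow.
      more-lost : ∀ y → S + q ≤ y C d → k * (lost + (# (del v 𝒜) + q)) ≤ (S + q) * (y + E)
      more-lost y S+q≤ = begin
        k * (lost + (# (del v 𝒜) + q))             ≡⟨ distribute k lost (# (del v 𝒜)) q ⟩
        k * lost + (k * # (del v 𝒜) + k * q)       ≤⟨ +-mono-≤ (lost-≤ y (≤-trans (m≤m+n S q) S+q≤))
                                                        (weak y _ _ (config-del v cfg) (≤-trans (m≤n+m q S) S+q≤)) ⟩
        S * (y + E) + q * (y + E)                  ≡⟨ *-distribʳ-+ (y + E) S q ⟨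
        (S + q) * (y + E)                          ∎
        where
        distribute : ∀ k a b c → k * (a + (b + c)) ≡ k * a + (k * b + k * c)
        distribute = solve-∀
    -- Both p and S + q exceed `θ`, so each is at most C(m, d), and p, q and S can all be charged at
    -- the ratio m + E = n - 2d.
    ... | no S+q≰θ = finish (m + E) m+E+2d≤n (begin
      k * (# 𝒜 + lost)
        ≤⟨ *-monoʳ-≤ k (+-monoˡ-≤ lost (#-decompose v 𝒜 ℬ)) ⟩
      k * (# (link v 𝒜 ∖ del v ℬ) + q + # (del v 𝒜) + lost)
        ≡⟨ distribute k (# (link v 𝒜 ∖ del v ℬ)) q (# (del v 𝒜)) lost ⟩
      k * # (link v 𝒜 ∖ del v ℬ) + (k * # (del v 𝒜) + k * q) + k * lost
        ≤⟨ +-mono-≤ (+-mono-≤ (≤-trans (m≤m+n (k * # (link v 𝒜 ∖ del v ℬ)) (k * p)) (weak m _ _ (config-link∖del v cfg) p≤))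
                              (weak m _ _ (config-del v cfg) (≤-trans (m≤n+m q S) S+q≤)))
                    (lost-≤ m (≤-trans (m≤m+n S q) S+q≤)) ⟩
      p * (m + E) + q * (m + E) + S * (m + E)
        ≡⟨ collect p q S (m + E) ⟩
      (p + q + S) * (m + E)
        ≤⟨ *-monoˡ-≤ (m + E) p+q+S≤ ⟩
      (suc n C d) * (m + E) ∎)
      where
      p = # (link v ℬ)
      q = # (del v ℬ)
      distribute : ∀ k a q b l → k * (a + q + b + l) ≡ k * a + (k * b + k * q) + k * l
      distribute = solve-∀
      collect : ∀ p q S t → p * t + q * t + S * t ≡ (p + q + S) * t
      collect = solve-∀
      swap : ∀ p q S → p + (S + q) ≡ p + q + S
      swap = solve-∀
      p+q+S≤ : p + q + S ≤ suc n C d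
      p+q+S≤ = ≤-trans (≤-reflexive (cong (_+ S) (sym (#-split v ℬ)))) (≤-trans b+S≤ val≤)
      S+q≤ : S + q ≤ m C d
      S+q≤ = +-≤∸ (≤-trans (≤-reflexive (swap p q S)) p+q+S≤) θ<p
      p≤ : p ≤ m C d
      p≤ = +-≤∸ (≤-trans (≤-reflexive (trans (+-comm (S + q) p) (swap p q S))) p+q+S≤) (≰⇒> S+q≰θ)
      m+E+2d≤n : m + E + 2 * d ≤ n
      m+E+2d≤n = ≤-reflexive (trans (+-assoc m E (2 * d)) (trans (cong (m +_) K≡) (m∸n+n≡m K≤n)))

upper-bound : ∀ e → let d = suc e in ∃[ μ ] (∀ c →
  (∀ i → 1 ≤ i → i ≤ d → μ ≤ c i) → (∀ i j → 1 ≤ i → i < j → j ≤ d → c i < c j) →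
  ∀ {N r} (𝒜 ℬ : 𝔽 N) → Config r (suc d) 𝒜 ℬ → # ℬ ≤ val d c → # 𝒜 ≤ val′ d c)
upper-bound e = from-weak (weak-bound e)
  where
  open ≤-Reasoning
  d k : ℕ
  d = suc e
  k = suc d
  Goal : Set
  Goal = ∃[ μ ] (∀ c →
    (∀ i → 1 ≤ i → i ≤ d → μ ≤ c i) → (∀ i j → 1 ≤ i → i < j → j ≤ d → c i < c j) →
    ∀ {N r} (𝒜 ℬ : 𝔽 N) → Config r k 𝒜 ℬ → # ℬ ≤ val d c → # 𝒜 ≤ val′ d c)
  Scale : ℕ → ℕ → ℕ → ℕ → Set
  Scale K L μ c = ∃[ y ] L * y ≤ c × (∀ j → j < d → (4 + suc K) * (c C j) ≤ y C d)
  from-scale : ∀ E K L →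
    (∀ {N r} n (𝒜 ℬ : 𝔽 N) → Config r k 𝒜 ℬ → # ℬ ≤ n C d → k * # 𝒜 + k * # ℬ ≤ # ℬ * (n + E)) →
    E + 2 * d ≡ K → 8 ≤ L → 2 * (k * k + 1) ≤ L →
    ∃[ μ ] (∀ c → μ ≤ c → Scale K L μ c) → Goal
  from-scale E K L weak K≡ 8≤L 2k²<L (μ , scale) =
    μ + (2 * (d + 4 * E) + 2 + 2 * K) , λ c c-large c-mono 𝒜 ℬ cfg b≤ →
      subst (_≤ val′ d c) (+-identityʳ (# 𝒜))
        (Accumulation.accumulated e E K L weak K≡ 8≤L 2k²<L c c-mono
          (λ i 1≤i i≤d → ≤-trans (≤-trans (m≤m+n _ (2 * K)) (m≤n+m _ μ)) (c-large i 1≤i i≤d))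
          (≤-trans (≤-trans (m≤n+m (2 * K) (2 * (d + 4 * E) + 2)) (m≤n+m _ μ)) (c-large d (s≤s z≤n) ≤-refl))
          (λ i 1≤i i≤d → scale (c i) (≤-trans (m≤m+n μ _) (c-large i 1≤i i≤d)))
          _ 0 0 𝒜 ℬ cfg (≤-trans (≤-reflexive (+-identityʳ (# ℬ))) b≤) z≤n
          (λ _ _ → ≤-reflexive (*-zeroʳ k)))
  from-weak : ∃[ E ] (∀ N {r} n (𝒜 ℬ : 𝔽 N) → Config r k 𝒜 ℬ → # ℬ ≤ n C d → k * # 𝒜 ≤ # ℬ * (n + E)) → Goal
  -- Raising E by k absorbs the additional k * # ℬ that `Accumulation` asks for.
  from-weak (E , bound) = from-scale (E + k) (E + k + 2 * d) (8 + 2 * (k * k + 1))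
    (λ n 𝒜 ℬ cfg b≤ → begin
      k * # 𝒜 + k * # ℬ             ≤⟨ +-monoˡ-≤ _ (bound _ n 𝒜 ℬ cfg b≤) ⟩
      # ℬ * (n + E) + k * # ℬ       ≡⟨ regroup (# ℬ) n E k ⟩
      # ℬ * (n + (E + k))           ∎)
    refl (m≤m+n 8 _) (m≤n+m _ 8) (C-dominates d (4 + suc (E + k + 2 * d)) (8 + 2 * (k * k + 1)))
    where
    regroup : ∀ b n E k → b * (n + E) + k * b ≡ b * (n + (E + k))
    regroup = solve-∀

-- From lists to families on a finite ground set

does⁻ : ∀ {p} {P : Set p} (P? : Dec P) → does P? ≡ true → P
does⁻ (yes p) _ = p

vec-ext : ∀ {x y : Vec Bool N} → (∀ v → lookup x v ≡ lookup y v) → x ≡ y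
vec-ext {x = x} {y} eq = trans (sym (Vec.tabulate∘lookup x)) (trans (Vec.tabulate-cong eq) (Vec.tabulate∘lookup y))

bool-ext : ∀ {a b} → (a ≡ true → b ≡ true) → (b ≡ true → a ≡ true) → a ≡ b
bool-ext {false} {false} f g = refl
bool-ext {false} {true}  f g = g refl
bool-ext {true}  {b}     f g = sym (f refl)

count-injective : ∀ N k (p : Fin N → Bool) (g : Fin k → Fin N) → Injective _≡_ _≡_ g →
                  (∀ i → p (g i) ≡ true) → k ≤ ∑ᶠ N (λ v → ⟦ p v ⟧)
count-injective N zero    p g inj all = z≤n
count-injective N (suc k) p g inj all = begin
  suc k                          ≤⟨ s≤s (count-injective N k (p without g zero) (g ∘ suc) (Fin.suc-injective ∘ inj) others) ⟩
  suc (∑ᶠ N (λ v → ⟦ (p without g zero) v ⟧))    ≡⟨ remove N p (g zero) (all zero) ⟨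
  ∑ᶠ N (λ v → ⟦ p v ⟧)           ∎
  where
  open ≤-Reasoning
  _without_ : ∀ {N} → (Fin N → Bool) → Fin N → Fin N → Bool
  (p without w) v = p v ∧ not (does (v Fin.≟ w))
  remove : ∀ N p w → p w ≡ true → ∑ᶠ N (λ v → ⟦ p v ⟧) ≡ suc (∑ᶠ N (λ v → ⟦ (p without w) v ⟧))
  remove (suc N) p zero    p-w rewrite p-w =
    cong suc (∑ᶠ-cong N λ v → cong ⟦_⟧ (sym (Bool.∧-identityʳ (p (suc v)))))
  remove (suc N) p (suc w) p-w = trans
    (cong₂ _+_ (cong ⟦_⟧ (sym (Bool.∧-identityʳ (p zero)))) (remove N (p ∘ suc) w p-w))
    (+-suc _ _)
  others : ∀ i → (p without g zero) (g (suc i)) ≡ true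
  others i rewrite all (suc i) | dec-false (g (suc i) Fin.≟ g zero) (λ eq → Fin.0≢1+n (sym (inj eq))) = refl

infix 4 _⊆ᶜ_

_⊆ᶜ_ : Vec Bool N → Vec Bool N → Set
y ⊆ᶜ x = ∀ v → lookup y v ≡ true → lookup x v ≡ true

⊆ᶜ⇒size-≤ : ∀ (y x : Vec Bool N) → y ⊆ᶜ x → size y ≤ size x
⊆ᶜ⇒size-≤ []          []          y⊆x = z≤n
⊆ᶜ⇒size-≤ (true  ∷ y) (true  ∷ x) y⊆x = s≤s (⊆ᶜ⇒size-≤ y x (y⊆x ∘ suc))
⊆ᶜ⇒size-≤ (true  ∷ y) (false ∷ x) y⊆x = contradiction (y⊆x zero refl) λ ()
⊆ᶜ⇒size-≤ (false ∷ y) (true  ∷ x) y⊆x = m≤n⇒m≤1+n (⊆ᶜ⇒size-≤ y x (y⊆x ∘ suc))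
⊆ᶜ⇒size-≤ (false ∷ y) (false ∷ x) y⊆x = ⊆ᶜ⇒size-≤ y x (y⊆x ∘ suc)

⊆ᶜ⇒≡ : ∀ (y x : Vec Bool N) → y ⊆ᶜ x → size x ≡ size y → y ≡ x
⊆ᶜ⇒≡ []          []          y⊆x eq = refl
⊆ᶜ⇒≡ (true  ∷ y) (true  ∷ x) y⊆x eq = cong (true ∷_) (⊆ᶜ⇒≡ y x (y⊆x ∘ suc) (suc-injective eq))
⊆ᶜ⇒≡ (true  ∷ y) (false ∷ x) y⊆x eq = contradiction (y⊆x zero refl) λ ()
⊆ᶜ⇒≡ (false ∷ y) (true  ∷ x) y⊆x eq =
  contradiction (≤-trans (≤-reflexive eq) (⊆ᶜ⇒size-≤ y x (y⊆x ∘ suc))) (<-irrefl refl)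
⊆ᶜ⇒≡ (false ∷ y) (false ∷ x) y⊆x eq = cong (false ∷_) (⊆ᶜ⇒≡ y x (y⊆x ∘ suc) eq)

⊆ᶜ⇒update : ∀ (y x : Vec Bool N) → y ⊆ᶜ x → size x ≡ suc (size y) →
            ∃[ v ] lookup x v ≡ true × y ≡ x [ v ]≔ false
⊆ᶜ⇒update (true  ∷ y) (true  ∷ x) y⊆x eq =
  let v , v∈ , y≡ = ⊆ᶜ⇒update y x (y⊆x ∘ suc) (suc-injective eq) in suc v , v∈ , cong (true ∷_) y≡
⊆ᶜ⇒update (true  ∷ y) (false ∷ x) y⊆x eq = contradiction (y⊆x zero refl) λ ()
⊆ᶜ⇒update (false ∷ y) (true  ∷ x) y⊆x eq =
  zero , refl , cong (false ∷_) (⊆ᶜ⇒≡ y x (y⊆x ∘ suc) (suc-injective eq))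
⊆ᶜ⇒update (false ∷ y) (false ∷ x) y⊆x eq =
  let v , v∈ , y≡ = ⊆ᶜ⇒update y x (y⊆x ∘ suc) eq in suc v , v∈ , cong (false ∷_) y≡

module ℕ∈ = DecMembership _≟_

χ : ∀ N → List ℕ → Vec Bool N
χ N xs = tabulate (λ v → does (toℕ v ℕ∈.∈? xs))

Bounded : ℕ → List ℕ → Set
Bounded N xs = ∀ {x} → x ∈ xs → x < N

χ⁺ : ∀ xs (v : Fin N) → toℕ v ∈ xs → lookup (χ N xs) v ≡ true
χ⁺ xs v v∈ = trans (Vec.lookup∘tabulate _ v) (dec-true (_ ℕ∈.∈? _) v∈)

χ⁻ : ∀ xs (v : Fin N) → lookup (χ N xs) v ≡ true → toℕ v ∈ xs
χ⁻ xs v eq = does⁻ (_ ℕ∈.∈? _) (trans (sym (Vec.lookup∘tabulate _ v)) eq)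

χ-mono : ∀ xs ys → (∀ {x} → x ∈ ys → x ∈ xs) → χ N ys ⊆ᶜ χ N xs
χ-mono xs ys ys⊆xs v v∈ = χ⁺ xs v (ys⊆xs (χ⁻ ys v v∈))

χ-reflects : ∀ {xs ys} → Bounded N ys → χ N xs ≡ χ N ys → ∀ {x} → x ∈ ys → x ∈ xs
χ-reflects {xs = xs} {ys} bounded eq {x} x∈ = subst (_∈ xs) toℕ-v
  (χ⁻ xs v (trans (cong (λ z → lookup z v) eq) (χ⁺ ys v (subst (_∈ ys) (sym toℕ-v) x∈))))
  where
  v = fromℕ< (bounded x∈)
  toℕ-v : toℕ v ≡ x
  toℕ-v = Fin.toℕ-fromℕ< (bounded x∈)

χ-∷ : ∀ x xs (x<N : x < N) → χ N (x ∷ xs) ≡ χ N xs [ fromℕ< x<N ]≔ true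
χ-∷ {N} x xs x<N = vec-ext same
  where
  w = fromℕ< x<N
  same : ∀ v → lookup (χ N (x ∷ xs)) v ≡ lookup (χ N xs [ w ]≔ true) v
  same v with v Fin.≟ w
  ... | yes refl = trans (χ⁺ (x ∷ xs) v (here (Fin.toℕ-fromℕ< x<N))) (sym (Vec.lookup∘update v (χ N xs) true))
  ... | no v≢w = trans (bool-ext (χ⁺ xs v ∘ other ∘ χ⁻ (x ∷ xs) v) (χ⁺ (x ∷ xs) v ∘ there ∘ χ⁻ xs v))
                       (sym (Vec.lookup∘update′ v≢w (χ N xs) true))
    where
    other : toℕ v ∈ x ∷ xs → toℕ v ∈ xs
    other (here v≡x)  = contradiction (Fin.toℕ-injective (trans v≡x (sym (Fin.toℕ-fromℕ< x<N)))) v≢w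
    other (there v∈)  = v∈

size-χ : ∀ {xs} → AllPairs _<_ xs → Bounded N xs → size (χ N xs) ≡ length xs
size-χ {N} [] bounded = empty N
  where
  empty : ∀ N → size (χ N []) ≡ 0
  empty zero    = refl
  empty (suc N) = empty N
size-χ {N} {x ∷ xs} (x<xs ∷ inc) bounded = begin
  size (χ N (x ∷ xs))                    ≡⟨ cong size (χ-∷ x xs x<N) ⟩
  size (χ N xs [ fromℕ< x<N ]≔ true)     ≡⟨ size-update (χ N xs) (fromℕ< x<N) w∉ ⟩
  suc (size (χ N xs))                    ≡⟨ cong suc (size-χ inc (bounded ∘ there)) ⟩
  suc (length xs)                        ∎
  where
  open ≡-Reasoning
  x<N = bounded (here refl)
  w∉ : lookup (χ N xs) (fromℕ< x<N) ≡ false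
  w∉ = Bool.¬-not λ w∈ → <-irrefl refl
    (All.lookup x<xs (subst (_∈ xs) (Fin.toℕ-fromℕ< x<N) (χ⁻ xs (fromℕ< x<N) w∈)))

sorted-≡ : ∀ {xs ys} → AllPairs _<_ xs → AllPairs _<_ ys →
           (∀ {x} → x ∈ xs → x ∈ ys) → (∀ {x} → x ∈ ys → x ∈ xs) → xs ≡ ys
sorted-≡ [] [] _ _ = refl
sorted-≡ [] (_ ∷ _) _ ⊇ = contradiction (⊇ (here refl)) λ ()
sorted-≡ (_ ∷ _) [] ⊆ _ = contradiction (⊆ (here refl)) λ ()
sorted-≡ {x ∷ xs} {y ∷ ys} (x<xs ∷ incˣ) (y<ys ∷ incʸ) ⊆ ⊇ =
  cong₂ _∷_ x≡y (sorted-≡ incˣ incʸ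
    (λ z∈ → drop (⊆ (there z∈)) (subst (_< _) x≡y (All.lookup x<xs z∈)))
    (λ z∈ → drop (⊇ (there z∈)) (subst (_< _) (sym x≡y) (All.lookup y<ys z∈))))
  where
  drop : ∀ {z w ws} → z ∈ w ∷ ws → w < z → z ∈ ws
  drop (here refl) w<z = contradiction w<z (<-irrefl refl)
  drop (there z∈)  _   = z∈
  x≡y : x ≡ y
  x≡y with ⊆ (here refl) | ⊇ (here refl)
  ... | here eq   | _         = eq
  ... | there _   | here eq   = sym eq
  ... | there x∈ys | there y∈xs = contradiction (All.lookup y<ys x∈ys) (<-asym (All.lookup x<xs y∈xs))

-- Being increasing is decidable, so the irrelevant field can be recomputed.
sorted : (A : FinSet) → AllPairs _<_ (elements A)
sorted (mkFinSet xs inc) = recompute (allPairs? _<?_ xs) inc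

FinSet-≡ : ∀ {A B} → elements A ≡ elements B → A ≡ B
FinSet-≡ refl = refl

χ-injective : ∀ {A B} → Bounded N (elements A) → Bounded N (elements B) →
              χ N (elements A) ≡ χ N (elements B) → A ≡ B
χ-injective {A = A} {B} boundedᴬ boundedᴮ eq = FinSet-≡
  (sorted-≡ (sorted A) (sorted B) (χ-reflects boundedᴬ (sym eq)) (χ-reflects boundedᴮ eq))

module _ {N : ℕ} where
  open DecMembership (Vec.≡-dec {n = N} Bool._≟_) public using () renaming (_∈?_ to _∈ᶜ?_)

members : List (Vec Bool N) → 𝔽 N
members L x = does (x ∈ᶜ? L)

#-members-≤ : ∀ (L : List (Vec Bool N)) → # (members L) ≤ length L
#-members-≤ {N} []      = ≤-reflexive (∑ᶜ-zero N λ _ → refl)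
#-members-≤ {N} (a ∷ L) = begin
  # (members (a ∷ L))                                       ≤⟨ ∑ᶜ-mono N bound ⟩
  ∑ᶜ N (λ x → ⟦ does (Vec.≡-dec Bool._≟_ x a) ⟧ + ⟦ members L x ⟧)  ≡⟨ ∑ᶜ-+ N _ _ ⟩
  # (λ x → does (Vec.≡-dec Bool._≟_ x a)) + # (members L)   ≤⟨ +-mono-≤ (≤-reflexive (singleton a)) (#-members-≤ L) ⟩
  suc (length L)                                            ∎
  where
  open ≤-Reasoning
  bound : ∀ x → ⟦ members (a ∷ L) x ⟧ ≤ ⟦ does (Vec.≡-dec Bool._≟_ x a) ⟧ + ⟦ members L x ⟧
  bound x with does (Vec.≡-dec Bool._≟_ x a) | members L x
  ... | true  | _ = s≤s z≤n
  ... | false | _ = ≤-refl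
  singleton : ∀ {N} (a : Vec Bool N) → # (λ x → does (Vec.≡-dec Bool._≟_ x a)) ≡ 1
  singleton []          = refl
  singleton {suc N} (true  ∷ a) = cong₂ _+_ (singleton a) (∑ᶜ-zero N λ _ → refl)
  singleton {suc N} (false ∷ a) = cong₂ _+_ (∑ᶜ-zero N λ _ → refl) (singleton a)

length≤#-members : ∀ As → Unique As → (∀ {A} → A ∈ As → Bounded N (elements A)) →
                   length As ≤ # (members (map (χ N ∘ elements) As))
length≤#-members []       _                  _       = z≤n
length≤#-members {N} (A ∷ As) (A∉As ∷ unique) bounded =
  ≤-<-trans (length≤#-members As unique (bounded ∘ there))
    (#-mono-< (λ x x∈ → dec-true (x ∈ᶜ? (a ∷ L)) (there (does⁻ (x ∈ᶜ? L) x∈))) a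
      (dec-false (a ∈ᶜ? L) fresh) (dec-true (a ∈ᶜ? (a ∷ L)) (here refl)))
  where
  a = χ N (elements A)
  L = map (χ N ∘ elements) As
  fresh : a ∉ L
  fresh χA∈ with ∈-map⁻ (χ N ∘ elements) χA∈
  ... | B , B∈ , eq = All.lookup A∉As B∈ (χ-injective (bounded (here refl)) (bounded (there B∈)) eq)

-- 𝒜 may be infinite, but only a finite list of its members is tested. With the finite list for ℬ it
-- has a common bound M on all elements, so both become families of Boolean vectors.
admissible-≤ : ∀ d c {r b} → (∀ {N r} (𝒜 ℬ : 𝔽 N) → Config r (suc d) 𝒜 ℬ → # ℬ ≤ b → # 𝒜 ≤ c) →
               ∀ 𝒜 ℬ → Admissible r (suc d) b 𝒜 ℬ → SizeAtMost 𝒜 c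
admissible-≤ d c {r} {b} bound 𝒜 ℬ adm As unique As⊆𝒜 with Admissible.ℬ-size adm
... | Bs , _ , refl , ℬ⇔Bs = ≤-trans
  (length≤#-members As unique (λ A∈ → boundedness (∈-++⁺ˡ A∈)))
  (bound (members (map code As)) (members (map code Bs)) config
    (≤-trans (#-members-≤ (map code Bs)) (≤-reflexive (length-map code Bs))))
  where
  open Admissible adm
  M : ℕ
  M = suc (max 0 (concatMap elements (As ++ Bs)))
  code : FinSet → Vec Bool M
  code A = χ M (elements A)
  boundedness : ∀ {A} → A ∈ As ++ Bs → Bounded M (elements A)
  boundedness A∈ x∈ = s≤s (All.lookup (xs≤max 0 (concatMap elements (As ++ Bs)))
    (∈-concatMap⁺ elements (Any.map (λ { refl → x∈ }) A∈)))
  size-code : ∀ {A} → A ∈ As ++ Bs → size (code A) ≡ card A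
  size-code {A} A∈ = size-χ (sorted A) (boundedness A∈)
  covers-code : ∀ {A} → A ∈ As → suc d ≤ τ (members (map code Bs)) (code A)
  covers-code {A} A∈ with covers A (All.lookup As⊆𝒜 A∈)
  ... | B , B-injective , B∈⊆ = subst (suc d ≤_) (sym (τ-sum _ (code A)))
    (count-injective M (suc d) (λ w → lookup (code A) w ∧ members L (code A [ w ]≔ false)) v v-injective λ i →
      cong₂ _∧_ (proj₁ (proj₂ (removal i)))
        (dec-true (_ ∈ᶜ? L) (subst (_∈ L) (proj₂ (proj₂ (removal i))) (∈-map⁺ code (B∈ i)))))
    where
    L = map code Bs
    B∈ : ∀ i → B i ∈ Bs
    B∈ i = Equivalence.to (ℬ⇔Bs (B i)) (proj₁ (B∈⊆ i))
    -- By cardinality, B i is A without one element, and distinct B i omit distinct elements; these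
    -- are what `τ` counts.
    removal : ∀ i → ∃[ w ] lookup (code A) w ≡ true × code (B i) ≡ code A [ w ]≔ false
    removal i = ⊆ᶜ⇒update (code (B i)) (code A) (χ-mono (elements A) (elements (B i)) (proj₂ (B∈⊆ i))) (begin
      size (code A)             ≡⟨ size-code (∈-++⁺ˡ A∈) ⟩
      card A                    ≡⟨ 𝒜-uniform A (All.lookup As⊆𝒜 A∈) ⟩
      r                         ≡⟨ ℬ-uniform (B i) (proj₁ (B∈⊆ i)) ⟨
      suc (card (B i))          ≡⟨ cong suc (size-code (∈-++⁺ʳ As (B∈ i))) ⟨
      suc (size (code (B i)))   ∎)
      where open ≡-Reasoning
    v : Fin (suc d) → Fin M
    v i = proj₁ (removal i)
    v-injective : Injective _≡_ _≡_ v
    v-injective {i} {j} eq = B-injective (χ-injective (boundedness (∈-++⁺ʳ As (B∈ i))) (boundedness (∈-++⁺ʳ As (B∈ j)))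
      (trans (proj₂ (proj₂ (removal i))) (trans (cong (code A [_]≔ false) eq) (sym (proj₂ (proj₂ (removal j)))))))
  config : Config r (suc d) (members (map code As)) (members (map code Bs))
  config = record
    { size-𝒜  = λ x x∈ → let A , A∈ , x≡ = ∈-map⁻ code (does⁻ (x ∈ᶜ? _) x∈) in
        trans (cong size x≡) (trans (size-code (∈-++⁺ˡ A∈)) (𝒜-uniform A (All.lookup As⊆𝒜 A∈)))
    ; size-ℬ  = λ x x∈ → let B , B∈ , x≡ = ∈-map⁻ code (does⁻ (x ∈ᶜ? _) x∈) in
        trans (cong (suc ∘ size) x≡) (trans (cong suc (size-code (∈-++⁺ʳ As B∈)))
          (ℬ-uniform B (Equivalence.from (ℬ⇔Bs B) B∈)))
    ; covered = λ x x∈ → let A , A∈ , x≡ = ∈-map⁻ code (does⁻ (x ∈ᶜ? _) x∈) in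
        subst (λ z → suc d ≤ τ _ z) (sym x≡) (covers-code A∈)
    }

-- The extremal families

-- Finite sets as decreasing lists, so that adding a new maximum is _∷_.
record Desc (n e : ℕ) (xs : List ℕ) : Set where
  constructor desc
  field
    decreasing : AllPairs _>_ xs
    bounded    : All (_< n) xs
    length-≡   : length xs ≡ e

open Desc

Desc-∷ : ∀ {n e xs} → Desc n e xs → Desc (suc n) (suc e) (n ∷ xs)
Desc-∷ (desc dec bnd len) = desc (bnd ∷ dec) (≤-refl ∷ All.map m≤n⇒m≤1+n bnd) (cong suc len)

Desc-≤ : ∀ {m n e xs} → m ≤ n → Desc m e xs → Desc n e xs
Desc-≤ m≤n (desc dec bnd len) = desc dec (All.map (λ x<m → ≤-trans x<m m≤n) bnd) len

∉-bounded : ∀ {n e xs} → Desc n e xs → n ∉ xs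
∉-bounded D n∈ = <-irrefl refl (All.lookup (bounded D) n∈)

subsets : ℕ → ℕ → List (List ℕ)
subsets n       zero    = [] ∷ []
subsets zero    (suc e) = []
subsets (suc n) (suc e) = subsets n (suc e) ++ map (n ∷_) (subsets n e)

length-subsets : ∀ n e → length (subsets n e) ≡ n C e
length-subsets n       zero    = refl
length-subsets zero    (suc e) = refl
length-subsets (suc n) (suc e) = begin
  length (subsets n (suc e) ++ map (n ∷_) (subsets n e))            ≡⟨ length-++ (subsets n (suc e)) ⟩
  length (subsets n (suc e)) + length (map (n ∷_) (subsets n e))    ≡⟨ cong₂ _+_ (length-subsets n (suc e)) (trans (length-map (n ∷_) (subsets n e)) (length-subsets n e)) ⟩
  n C suc e + n C e                                                 ≡⟨ +-comm (n C suc e) (n C e) ⟩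
  n C e + n C suc e                                                 ≡⟨ pascal n e ⟨
  suc n C suc e                                                     ∎
  where open ≡-Reasoning

subsets-sound : ∀ n e {xs} → xs ∈ subsets n e → Desc n e xs
subsets-sound n       zero    (here refl) = desc [] [] refl
subsets-sound (suc n) (suc e) xs∈ with ∈-++⁻ (subsets n (suc e)) xs∈
... | inj₁ xs∈₁ = Desc-≤ (n≤1+n n) (subsets-sound n (suc e) xs∈₁)
... | inj₂ xs∈₂ with ∈-map⁻ (n ∷_) xs∈₂
... | ys , ys∈ , refl = Desc-∷ (subsets-sound n e ys∈)

subsets-complete : ∀ n e {xs} → Desc n e xs → xs ∈ subsets n e
subsets-complete n       zero    {[]}     D = here refl
subsets-complete zero    (suc e) {x ∷ xs} (desc _ (() ∷ _) _)
subsets-complete (suc n) (suc e) {x ∷ xs} (desc (x>xs ∷ dec) (x<1+n ∷ bnd) len) with x ≟ n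
... | yes refl = ∈-++⁺ʳ (subsets n (suc e)) (∈-map⁺ (n ∷_) (subsets-complete n e (desc dec x>xs (suc-injective len))))
... | no x≢n   = ∈-++⁺ˡ (subsets-complete n (suc e) (desc (x>xs ∷ dec) (x<n ∷ All.map (λ y<x → <-trans y<x x<n) x>xs) len))
  where
  x<n : x < n
  x<n = ≤∧≢⇒< (≤-pred x<1+n) x≢n

Unique-∷ : ∀ n {L : List (List ℕ)} → Unique L → Unique (map (n ∷_) L)
Unique-∷ n = Unique.map⁺ ∷-injectiveʳ

Unique-++-∷ : ∀ {n e L L′} → (∀ {xs} → xs ∈ L → Desc n e xs) →
              Unique L → Unique L′ → Unique (L ++ map (n ∷_) L′)
Unique-++-∷ {n} {L = L} {L′} D unique unique′ =
  Unique.++⁺ unique (Unique-∷ n unique′) λ (xs∈ , xs∈′) → disjoint xs∈ xs∈′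
  where
  disjoint : ∀ {xs} → xs ∈ L → xs ∉ map (n ∷_) L′
  disjoint xs∈ xs∈′ with ∈-map⁻ (n ∷_) xs∈′
  ... | ys , _ , refl = ∉-bounded (D xs∈) (here refl)

subsets-unique : ∀ n e → Unique (subsets n e)
subsets-unique n       zero    = [] ∷ []
subsets-unique zero    (suc e) = []
subsets-unique (suc n) (suc e) =
  Unique-++-∷ (subsets-sound n (suc e)) (subsets-unique n (suc e)) (subsets-unique n e)

Subsets : ℕ → List (List ℕ) → List ℕ → Set
Subsets k Bs xs = ∃[ g ] Injective {A = Fin k} _≡_ _≡_ g × (∀ i → g i ∈ Bs × (∀ {x} → x ∈ g i → x ∈ xs))

Subsets-cons : ∀ {k Bs n xs} → Subsets k Bs xs → Subsets k (map (n ∷_) Bs) (n ∷ xs)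
Subsets-cons {n = n} (g , g-injective , g∈) = (n ∷_) ∘ g , g-injective ∘ ∷-injectiveʳ ,
  λ i → ∈-map⁺ (n ∷_) (proj₁ (g∈ i)) , λ { (here eq) → here eq ; (there x∈) → there (proj₂ (g∈ i) x∈) }

Subsets-++ˡ : ∀ {k Bs Bs′ xs} → Subsets k Bs xs → Subsets k (Bs ++ Bs′) xs
Subsets-++ˡ (g , g-injective , g∈) = g , g-injective , λ i → ∈-++⁺ˡ (proj₁ (g∈ i)) , proj₂ (g∈ i)

-- Removing the maximum n of n ∷ xs, or an element of xs.
Subsets-suc : ∀ {k n e xs Bs Bs′} → Desc n e xs → xs ∈ Bs → Subsets k Bs′ xs →
              Subsets (suc k) (Bs ++ map (n ∷_) Bs′) (n ∷ xs)
Subsets-suc {k} {n} {xs = xs} {Bs} {Bs′} D xs∈ S = h , h-injective , h∈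
  where
  S∷ = Subsets-cons {n = n} S
  h : Fin (suc k) → List ℕ
  h zero    = xs
  h (suc i) = proj₁ S∷ i
  h-injective : Injective _≡_ _≡_ h
  h-injective {zero}  {zero}  _  = refl
  h-injective {zero}  {suc j} eq = contradiction (subst (n ∈_) (sym eq) (here refl)) (∉-bounded D)
  h-injective {suc i} {zero}  eq = contradiction (subst (n ∈_) eq (here refl)) (∉-bounded D)
  h-injective {suc i} {suc j} eq = cong suc (proj₁ (proj₂ S∷) eq)
  h∈ : ∀ i → h i ∈ Bs ++ map (n ∷_) Bs′ × (∀ {x} → x ∈ h i → x ∈ n ∷ xs)
  h∈ zero    = ∈-++⁺ˡ xs∈ , there
  h∈ (suc i) = ∈-++⁺ʳ Bs (proj₁ (proj₂ (proj₂ S∷) i)) , proj₂ (proj₂ (proj₂ S∷) i)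

subsets-full : ∀ n e {xs} → Desc n (suc e) xs → Subsets (suc e) (subsets n e) xs
subsets-full zero    e {x ∷ xs} (desc _ (() ∷ _) _)
subsets-full (suc n) zero {x ∷ []} D = (λ _ → []) , (λ { {zero} {zero} _ → refl }) , λ _ → here refl , λ ()
subsets-full (suc n) (suc e) {x ∷ xs} (desc (x>xs ∷ dec) (x<1+n ∷ bnd) len) with x ≟ n
... | yes refl = Subsets-suc D (subsets-complete n (suc e) D) (subsets-full n e D)
  where D = desc dec x>xs (suc-injective len)
... | no x≢n = Subsets-++ˡ (subsets-full n (suc e) (desc (x>xs ∷ dec) (x<n ∷ All.map (λ y<x → <-trans y<x x<n) x>xs) len))
  where
  x<n : x < n
  x<n = ≤∧≢⇒< (≤-pred x<1+n) x≢n

record Covering (k r n : ℕ) (As Bs : List (List ℕ)) : Set where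
  field
    As-desc   : ∀ {xs} → xs ∈ As → Desc n (suc r) xs
    Bs-desc   : ∀ {xs} → xs ∈ Bs → Desc n r xs
    As-unique : Unique As
    Bs-unique : Unique Bs
    covers    : ∀ {xs} → xs ∈ As → Subsets k Bs xs

add-top : ∀ {k r n As Bs} → Covering k r n As Bs → Covering k (suc r) (suc n) (map (n ∷_) As) (map (n ∷_) Bs)
add-top {n = n} {As} {Bs} cov = record
  { As-desc   = λ xs∈ → let ys , ys∈ , eq = ∈-map⁻ (n ∷_) xs∈ in subst (Desc _ _) (sym eq) (Desc-∷ (As-desc ys∈))
  ; Bs-desc   = λ xs∈ → let ys , ys∈ , eq = ∈-map⁻ (n ∷_) xs∈ in subst (Desc _ _) (sym eq) (Desc-∷ (Bs-desc ys∈))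
  ; As-unique = Unique-∷ n As-unique
  ; Bs-unique = Unique-∷ n Bs-unique
  ; covers    = λ xs∈ → let ys , ys∈ , eq = ∈-map⁻ (n ∷_) xs∈ in
                subst (Subsets _ (map (n ∷_) Bs)) (sym eq) (Subsets-cons (covers ys∈))
  }
  where open Covering cov

-- Initial segments of the colexicographic order.
cascade : ∀ d (c : ℕ → ℕ) → (∀ i j → 1 ≤ i → i < j → j ≤ d → c i < c j) →
          ∃[ n ] ∃[ As ] ∃[ Bs ] Covering (suc d) d n As Bs × length As ≡ val′ d c × length Bs ≡ val d c ×
          (∀ j → d < j → (∀ i → 1 ≤ i → i ≤ d → c i < c j) → n ≤ c j)
cascade zero c c-mono = 0 , [] , [] , record
  { As-desc = λ () ; Bs-desc = λ () ; As-unique = [] ; Bs-unique = [] ; covers = λ () } , refl , refl , λ _ _ _ → z≤n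
cascade (suc d) c c-mono with cascade d c (λ i j 1≤i i<j j≤d → c-mono i j 1≤i i<j (m≤n⇒m≤1+n j≤d))
... | n₀ , As , Bs , cov , #As , #Bs , n₀≤ =
  suc n , subsets n (2+ d) ++ map (n ∷_) As , subsets n (suc d) ++ map (n ∷_) Bs , record
    { As-desc   = λ xs∈ → As-desc′ (∈-++⁻ (subsets n (2+ d)) xs∈)
    ; Bs-desc   = λ xs∈ → Bs-desc′ (∈-++⁻ (subsets n (suc d)) xs∈)
    ; As-unique = Unique-++-∷ (subsets-sound n (2+ d)) (subsets-unique n (2+ d)) As-unique
    ; Bs-unique = Unique-++-∷ (subsets-sound n (suc d)) (subsets-unique n (suc d)) Bs-unique
    ; covers    = λ xs∈ → covers′ (∈-++⁻ (subsets n (2+ d)) xs∈)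
    } , count (2+ d) As #As , count (suc d) Bs #Bs , λ j d<j below → below (suc d) (s≤s z≤n) ≤-refl
  where
  open Covering cov
  n = c (suc d)
  -- As c increases strictly, the sets of the lower levels have all elements below n, so prefixing n
  -- adds a new maximum.
  n₀≤n : n₀ ≤ n
  n₀≤n = n₀≤ (suc d) ≤-refl (λ i 1≤i i≤d → c-mono i (suc d) 1≤i (s≤s i≤d) ≤-refl)
  count : ∀ e L {v} → length L ≡ v → length (subsets n e ++ map (n ∷_) L) ≡ v + n C e
  count e L refl = trans (length-++ (subsets n e))
    (trans (cong₂ _+_ (length-subsets n e) (length-map (n ∷_) L)) (+-comm (n C e) (length L)))
  ∷-desc : ∀ {L e} → (∀ {xs} → xs ∈ L → Desc n₀ e xs) → ∀ {xs} → xs ∈ map (n ∷_) L → Desc (suc n) (suc e) xs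
  ∷-desc D xs∈ with ∈-map⁻ (n ∷_) xs∈
  ... | ys , ys∈ , refl = Desc-∷ (Desc-≤ n₀≤n (D ys∈))
  As-desc′ : ∀ {xs} → xs ∈ subsets n (2+ d) ⊎ xs ∈ map (n ∷_) As → Desc (suc n) (2+ d) xs
  As-desc′ (inj₁ xs∈) = Desc-≤ (n≤1+n n) (subsets-sound n (2+ d) xs∈)
  As-desc′ (inj₂ xs∈) = ∷-desc As-desc xs∈
  Bs-desc′ : ∀ {xs} → xs ∈ subsets n (suc d) ⊎ xs ∈ map (n ∷_) Bs → Desc (suc n) (suc d) xs
  Bs-desc′ (inj₁ xs∈) = Desc-≤ (n≤1+n n) (subsets-sound n (suc d) xs∈)
  Bs-desc′ (inj₂ xs∈) = ∷-desc Bs-desc xs∈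
  covers′ : ∀ {xs} → xs ∈ subsets n (2+ d) ⊎ xs ∈ map (n ∷_) As →
            Subsets (2+ d) (subsets n (suc d) ++ map (n ∷_) Bs) xs
  covers′ (inj₁ xs∈) = Subsets-++ˡ (subsets-full n (suc d) (subsets-sound n (2+ d) xs∈))
  covers′ (inj₂ xs∈) with ∈-map⁻ (n ∷_) xs∈
  ... | ys , ys∈ , refl = Subsets-suc D (subsets-complete n (suc d) D) (covers ys∈)
    where D = Desc-≤ n₀≤n (As-desc ys∈)

-- A new maximum shared by all sets of both families preserves the counts and the containments,
-- which carries the construction for r = k to larger r.
pad : ∀ {k r n As Bs} s → Covering k r n As Bs →
      ∃[ n′ ] ∃[ As′ ] ∃[ Bs′ ] Covering k (s + r) n′ As′ Bs′ × length As′ ≡ length As × length Bs′ ≡ length Bs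
pad zero    cov = _ , _ , _ , cov , refl , refl
pad (suc s) cov with pad s cov
... | n , As , Bs , cov′ , #As , #Bs =
  _ , _ , _ , add-top cov′ , trans (length-map (n ∷_) As) #As , trans (length-map (n ∷_) Bs) #Bs

-- From decreasing lists to families of finite sets

reverse-increasing : ∀ {xs} → AllPairs _>_ xs → AllPairs _<_ (reverse xs)
reverse-increasing []                        = []
reverse-increasing {x ∷ xs} (x>xs ∷ dec) = subst (AllPairs _<_) (sym (unfold-reverse x xs))
  (AllPairs.++⁺ (reverse-increasing dec) ([] ∷ [])
    (All.tabulate λ y∈ → All.lookup x>xs (Any.reverse⁻ y∈) ∷ []))

toSets : ∀ L → All (AllPairs _>_) L → List FinSet
toSets []       []         = []
toSets (xs ∷ L) (dec ∷ decs) = mkFinSet (reverse xs) (reverse-increasing dec) ∷ toSets L decs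

length-toSets : ∀ L decs → length (toSets L decs) ≡ length L
length-toSets []       []           = refl
length-toSets (xs ∷ L) (dec ∷ decs) = cong suc (length-toSets L decs)

toSets⁻ : ∀ L decs {A} → A ∈ toSets L decs → ∃[ xs ] xs ∈ L × elements A ≡ reverse xs
toSets⁻ (xs ∷ L) (dec ∷ decs) (here refl) = xs , here refl , refl
toSets⁻ (xs ∷ L) (dec ∷ decs) (there A∈)  =
  let ys , ys∈ , eq = toSets⁻ L decs A∈ in ys , there ys∈ , eq

toSets⁺ : ∀ L decs {xs} → xs ∈ L → ∃[ A ] A ∈ toSets L decs × elements A ≡ reverse xs
toSets⁺ (xs ∷ L) (dec ∷ decs) (here refl) = _ , here refl , refl
toSets⁺ (xs ∷ L) (dec ∷ decs) (there xs∈) =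
  let A , A∈ , eq = toSets⁺ L decs xs∈ in A , there A∈ , eq

toSets-unique : ∀ L decs → Unique L → Unique (toSets L decs)
toSets-unique []       []           []               = []
toSets-unique (xs ∷ L) (dec ∷ decs) (xs∉L ∷ unique) =
  All.tabulate (λ A∈ eq → let ys , ys∈ , eq′ = toSets⁻ L decs A∈ in
    All.lookup xs∉L ys∈ (reverse-injective (trans (cong elements eq) eq′)))
  ∷ toSets-unique L decs unique

module _ {k r n : ℕ} {As Bs : List (List ℕ)} (cov : Covering k r n As Bs) where
  open Covering cov

  private
    As-dec : All (AllPairs _>_) As
    As-dec = All.tabulate λ {xs} xs∈ → decreasing (As-desc {xs} xs∈)
    Bs-dec : All (AllPairs _>_) Bs
    Bs-dec = All.tabulate λ {xs} xs∈ → decreasing (Bs-desc {xs} xs∈)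
    𝒜 ℬ : Family
    𝒜 A = A ∈ toSets As As-dec
    ℬ B = B ∈ toSets Bs Bs-dec

    card-≡ : ∀ {A xs e} → elements A ≡ reverse xs → Desc n e xs → card A ≡ e
    card-≡ {xs = xs} eq D = trans (cong length eq) (trans (length-reverse xs) (length-≡ D))

  covering⇒admissible : ∃[ 𝒜 ] ∃[ ℬ ] Admissible (suc r) k (length Bs) 𝒜 ℬ × HasSize 𝒜 (length As)
  covering⇒admissible = 𝒜 , ℬ , record
    { 𝒜-uniform = λ A A∈ → let xs , xs∈ , eq = toSets⁻ As As-dec A∈ in card-≡ {A} eq (As-desc xs∈)
    ; ℬ-uniform = λ B B∈ → let xs , xs∈ , eq = toSets⁻ Bs Bs-dec B∈ in cong suc (card-≡ {B} eq (Bs-desc xs∈))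
    ; ℬ-size    = _ , toSets-unique Bs Bs-dec Bs-unique , length-toSets Bs Bs-dec , λ _ → mk⇔ id id
    ; covers    = covers-set
    } , (_ , toSets-unique As As-dec As-unique , length-toSets As As-dec , λ _ → mk⇔ id id)
    where
    covers-set : ∀ A → A ∈ toSets As As-dec → ContainsDistinct k ℬ A
    covers-set A A∈ with toSets⁻ As As-dec A∈
    ... | xs , xs∈ , eq with covers xs∈
    ... | g , g-injective , g∈ = B , B-injective , λ i → proj₁ (proj₂ (found i)) , λ {x} x∈ →
      subst (x ∈_) (sym eq) (Any.reverse⁺ (proj₂ (g∈ i) (Any.reverse⁻ (subst (x ∈_) (proj₂ (proj₂ (found i))) x∈))))
      where
      found : ∀ i → ∃[ B ] B ∈ toSets Bs Bs-dec × elements B ≡ reverse (g i)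
      found i = toSets⁺ Bs Bs-dec (proj₁ (g∈ i))
      B : Fin k → FinSet
      B i = proj₁ (found i)
      B-injective : Injective _≡_ _≡_ B
      B-injective {i} {j} eq = g-injective (reverse-injective
        (trans (sym (proj₂ (proj₂ (found i)))) (trans (cong elements eq) (proj₂ (proj₂ (found j))))))

-- Combining the construction with the upper bound

∑₁≡∑ : ∀ n g → ∑₁ n g ≡ ∑ n g
∑₁≡∑ zero    g = refl
∑₁≡∑ (suc n) g = begin
  ListAction.sum (applyUpTo (g ∘ suc) (suc n))                 ≡⟨ cong ListAction.sum (applyUpTo-∷ʳ (g ∘ suc) n) ⟨
  ListAction.sum (applyUpTo (g ∘ suc) n ++ g (suc n) ∷ [])     ≡⟨ ListAction.sum-++ (applyUpTo (g ∘ suc) n) (g (suc n) ∷ []) ⟩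
  ∑₁ n g + (g (suc n) + 0)                               ≡⟨ cong₂ _+_ (∑₁≡∑ n g) (+-identityʳ (g (suc n))) ⟩
  ∑ n g + g (suc n)                                      ∎
  where open ≡-Reasoning

maximum : ∀ d → ∃[ μ ] (∀ r → suc d ≤ r → ∀ c → (∀ i → 1 ≤ i → i ≤ d → μ ≤ c i) →
  (∀ i j → 1 ≤ i → i < j → j ≤ d → c i < c j) → f⟨ r , suc d , val d c ⟩≡ val′ d c)
maximum d = let μ , upper = bound d in μ , λ r d<r c c-large c-mono →
  attained r d<r c c-mono , admissible-≤ d (val′ d c) (upper c c-large c-mono)
  where
  attained : ∀ r → suc d ≤ r → ∀ c → (∀ i j → 1 ≤ i → i < j → j ≤ d → c i < c j) →
             ∃[ 𝒜 ] ∃[ ℬ ] Admissible r (suc d) (val d c) 𝒜 ℬ × HasSize 𝒜 (val′ d c)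
  attained r d<r c c-mono with cascade d c c-mono
  ... | _ , As , Bs , cov , #As , #Bs , _ with pad (r ∸ suc d) cov
  ... | _ , As′ , Bs′ , cov′ , #As′ , #Bs′ =
    subst₂ (λ r b → ∃[ 𝒜 ] ∃[ ℬ ] Admissible r (suc d) b 𝒜 ℬ × HasSize 𝒜 (val′ d c))
      (trans (sym (+-suc (r ∸ suc d) d)) (m∸n+n≡m d<r)) (trans #Bs′ #Bs)
      (subst (λ m → ∃[ 𝒜 ] ∃[ ℬ ] Admissible (suc (r ∸ suc d + d)) (suc d) (length Bs′) 𝒜 ℬ × HasSize 𝒜 m)
        (trans #As′ #As) (covering⇒admissible cov′))

  bound : ∀ d → ∃[ μ ] (∀ c → (∀ i → 1 ≤ i → i ≤ d → μ ≤ c i) →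
    (∀ i j → 1 ≤ i → i < j → j ≤ d → c i < c j) →
    ∀ {N r} (𝒜 ℬ : 𝔽 N) → Config r (suc d) 𝒜 ℬ → # ℬ ≤ val d c → # 𝒜 ≤ val′ d c)
  -- For k = 1 the sums are empty, so ℬ is empty and the crude bound with y = 0 leaves no room for
  -- 𝒜.
  bound zero    = 0 , λ c _ _ 𝒜 ℬ cfg b≤0 →
    ≤-trans (crude-bound _ 0 0 𝒜 ℬ (Config.covered cfg) (s≤s b≤0)) (≤-reflexive (*-zeroʳ (# ℬ)))
  bound (suc e) = upper-bound e

theorem2 : ∀ (k : ℕ) → 1 ≤ k →
    ∃[ μ ] (∀ (r : ℕ) → k ≤ r → (c : ℕ → ℕ) →
    (∀ i → 1 ≤ i → i < k → μ < c i) →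
    (∀ i j → 1 ≤ i → i < j → j < k → c i < c j) →
    f⟨ r , k , ∑₁ (k ∸ 1) (λ i → c i C i) ⟩≡ ∑₁ (k ∸ 1) (λ i → c i C suc i))
theorem2 (suc d) _ = let μ , max = maximum d in μ , λ r k≤r c c-large c-mono →
  subst₂ (λ b m → f⟨ r , suc d , b ⟩≡ m) (sym (∑₁≡∑ d (λ i → c i C i))) (sym (∑₁≡∑ d (λ i → c i C suc i)))
    (max r k≤r c (λ i 1≤i i≤d → <⇒≤ (c-large i 1≤i (s≤s i≤d)))
      (λ i j 1≤i i<j j≤d → c-mono i j 1≤i i<j (s≤s j≤d)))
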